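{- For every positive integer $n$ with $n\neq 3$, the bar visibility number of the complete bipartite graph $K_{n,n}$ is $b(K_{n,n})=\left\lceil \frac{n+1}{4}\right\rceil$. Moreover, $b(K_{3,3})=2$.
   Context: A bar is a horizontal line segment in the plane. A $t$-bar visibility representation of a graph $G$ assigns to each vertex of $G$ at most $t$ pairwise disjoint bars so that two vertices are adjacent if and only if some bar assigned to one of them sees some bar assigned to the other, where two bars see each other if there is an axis-parallel rectangle of positive width whose bottom side lies in one bar and top side lies in the other and whose interior meets no other bar (an unobstructed vertical channel of positive width). The bar visibility number $b(G)$ is the least integer $t$ such that $G$ has a $t$-bar visibility representation.
   Formalization: Bars and visibility rectangles have rational instead of real coordinates; since visibility depends only on the order of the finitely many coordinates, this does not change the bar visibility number. -}

module Defs where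

open import Data.Nat using (ℕ; _≤_; _+_; _/_)
open import Data.Rational using (ℚ; _<_)
open import Data.List using (List; length; lookup)
open import Data.Fin using (Fin)
open import Data.Sum using (_⊎_; inj₁; inj₂)
open import Data.Product using (Σ; Σ-syntax; _×_; ∃-syntax; proj₁; _,_)
open import Data.Unit using (⊤)
open import Data.Empty using (⊥)
open import Relation.Binary.PropositionalEquality using (_≡_; _≢_)
open import Relation.Nullary using (¬_)
open import Function.Bundles using (_⇔_)

record Graph : Set₁ where
  field
    V   : Set
    Adj : V → V → Set
open Graph public

-- A bar: the closed horizontal segment [l , r] × {y}, with l < r (non-degenerate).
-- Coordinates are rational.
record Bar : Set where
  constructor bar
  field
    y   : ℚ
    l   : ℚ
    r   : ℚ
    l<r : l < r
open Bar public

Disjoint : Bar → Bar → Set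
Disjoint b c = (y b ≢ y c) ⊎ ((r b < l c) ⊎ (r c < l b))

MeetsInterior : Bar → ℚ → ℚ → ℚ → ℚ → Set
MeetsInterior d a c y₁ y₂ = (y₁ < y d) × (y d < y₂) × (l d < c) × (a < r d)

-- Bar b (bottom) sees bar c (top) upward within a family of bars
-- indexed by I: there is a rectangle [a , c'] × [y b , y c] of positive width
-- with bottom side in b, top side in c, whose interior meets no bar of the family.
SeesUp : {I : Set} → (I → Bar) → Bar → Bar → Set
SeesUp {I} bs b c =
  (y b < y c) ×
  Σ[ a ∈ ℚ ] Σ[ a' ∈ ℚ ]
    (a < a') ×
    (¬ (a < l b)) × (¬ (r b < a')) ×
    (¬ (a < l c)) × (¬ (r c < a')) ×
    ((i : I) → ¬ MeetsInterior (bs i) a a' (y b) (y c))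

Sees : {I : Set} → (I → Bar) → Bar → Bar → Set
Sees bs b c = SeesUp bs b c ⊎ SeesUp bs c b

BarIx : {W : Set} → (W → List Bar) → Set
BarIx {W} bars = Σ[ v ∈ W ] Fin (length (bars v))

barAt : {W : Set} (bars : W → List Bar) → BarIx bars → Bar
barAt bars (v , i) = lookup (bars v) i

record BarRep (G : Graph) (t : ℕ) : Set where
  field
    bars      : V G → List Bar
    atMost    : ∀ v → length (bars v) ≤ t
    disjoint  : (p q : BarIx bars) → p ≢ q → Disjoint (barAt bars p) (barAt bars q)
    adjacency : (u v : V G) → u ≢ v →
      Adj G u v ⇔ (∃[ i ] ∃[ j ] Sees (barAt bars) (lookup (bars u) i) (lookup (bars v) j))

BarVisNumberIs : Graph → ℕ → Set
BarVisNumberIs G t = BarRep G t × ((s : ℕ) → BarRep G s → t ≤ s)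

KAdj : {n : ℕ} → Fin n ⊎ Fin n → Fin n ⊎ Fin n → Set
KAdj (inj₁ _) (inj₁ _) = ⊥
KAdj (inj₁ _) (inj₂ _) = ⊤
KAdj (inj₂ _) (inj₁ _) = ⊤
KAdj (inj₂ _) (inj₂ _) = ⊥

K : ℕ → Graph
K n = record { V = Fin n ⊎ Fin n ; Adj = KAdj }

⌈_/4⌉ : ℕ → ℕ
⌈ m /4⌉ = (m + 3) / 4

{-# OPTIONS --safe #-}
-- Lower bound.  Sweep a vertical line from left to right over a layout with N bars and regard the
-- stack of bars it meets as a cycle.  If b bichromatic pairs are adjacent in this cycle, the start or
-- the end of one bar creates at most 1 + Δb/2 new adjacencies between the two sides, because among
-- three bars at most two pairs are bichromatic.  The 2N events thus create at most 2N adjacencies, and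
-- the stacks of fewer than three bars at both ends of the sweep save four of them (once N ≥ 3).  Hence
-- n² + 4 ≤ 2N ≤ 4nt.
--
-- Upper bound.  In a layout whose rows carry X- and Y-bars alternately and have no gaps, only X–Y
-- pairs see each other, so it is enough to make every X–Y pair meet with t bars per vertex.  Apart from
-- at most one extra vertex on each side, X consists of pairs A i, B i and Y of pairs C i, D i with
-- i < M.  In block i the bars A i (row 1) and B i (row 3) persist while row 2 runs through half of
-- the pairs C j, D j; then D i (row 2) and C i (row 4) persist while row 3 runs through half of the
-- pairs A j, B j.  Which half contains j depends on i − j modulo M, so that each vertex is met by about
-- M/2 short bars and one long one.  The change from one block to the next is arranged so that one spare
-- bar of each C i and D i supplies the pairs with equal or consecutive indices, and the extra vertices
-- are two bars along the bottom and the top.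
module Submission where

open import Defs
open import Data.Nat
open import Data.Nat.DivMod
open import Data.Nat.Divisibility using (n∣m*n)
open import Data.Nat.Properties
open import Data.Nat.Coprimality as Coprime using (1-coprimeTo)
open import Data.Nat.Tactic.RingSolver using (solve-∀)
import Data.Integer as ℤ
import Data.Integer.Properties as ℤ
open import Data.Rational as ℚ using (ℚ; mkℚ)
import Data.Rational.Properties as ℚ
open import Data.Fin as Fin using (Fin; zero; suc; toℕ)
import Data.Fin.Properties as Fin
open import Data.List using (List; []; _∷_; _++_; length; map; filter; upTo; concatMap; allFin; cartesianProduct; lookup)
open import Data.List.Properties using (length-map; length-++; length-tabulate; length-upTo; map-++; ++-assoc; ++-identityʳ)
open import Data.List.Membership.Propositional using (_∈_)
open import Data.List.Membership.Propositional.Properties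
open import Data.List.Relation.Unary.All as All using (All; []; _∷_)
import Data.List.Relation.Unary.All.Properties as All
open import Data.List.Relation.Unary.AllPairs as AllPairs using (AllPairs; []; _∷_)
import Data.List.Relation.Unary.AllPairs.Properties as AllPairs
open import Data.List.Relation.Unary.Any as Any using (here; there)
import Data.List.Relation.Unary.Any.Properties as Any
open import Data.List.Relation.Unary.Linked as Linked using (Linked; []; [-]; _∷_)
open import Data.List.Relation.Unary.Linked.Properties using (Linked⇒AllPairs)
open import Data.List.Relation.Unary.Unique.Propositional using (Unique)
import Data.List.Relation.Unary.Unique.Propositional.Properties as Unique
open import Data.List.Relation.Binary.Permutation.Propositional using (_↭_; ↭-sym; ↭-trans; ↭-reflexive; ↭⇒↭ₛ)
open import Data.List.Relation.Binary.Permutation.Propositional.Properties using (∈-resp-↭; ↭-length; ++-comm; shift)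
import Data.List.Relation.Binary.Permutation.Setoid.Properties as Permₛ
open import Data.List.Relation.Binary.Subset.Propositional using (_⊆_)
open import Data.List.Relation.Binary.Subset.Propositional.Properties using (⊆-refl; xs⊆ys++xs; xs⊆xs++ys)
import Data.List.Sort as Sort
open import Data.Maybe as Maybe using (Maybe; just; nothing; _>>=_)
open import Data.Maybe.Properties as Maybe using (just-injective)
open import Data.Vec as Vec using (Vec; []; _∷_)
import Data.Vec.Properties as Vec
open import Data.Product using (_×_; _,_; Σ-syntax; ∃-syntax; proj₁; proj₂)
open import Data.Sum as Sum using (_⊎_; inj₁; inj₂; [_,_]′)
open import Data.Sum.Properties as Sum using (inj₁-injective; inj₂-injective)
open import Data.Sum.Function.Propositional using (_⊎-↔_)
open import Data.Empty using (⊥; ⊥-elim)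
open import Data.Unit using (⊤; tt)
open import Function using (_∘_; _↔_; mk⇔; Inverse; Equivalence)
open import Function.Construct.Composition using (_↔-∘_)
open import Function.Construct.Identity using (↔-id)
open import Relation.Binary.Definitions using (DecidableEquality; tri<; tri≈; tri>)
import Relation.Binary.Construct.On as On
open import Relation.Binary.PropositionalEquality
open import Relation.Nullary using (¬_; Dec; yes; no; contradiction)
open import Relation.Nullary.Decidable using (_×-dec_; _⊎-dec_; _→-dec_; True; toWitness)

-- The bound n² + 4 ≤ 2N is the Euler bound e ≤ 2N - 4 for bipartite planar graphs, obtained without
-- planarity: on a cyclic stack each event changes one triangle only. The four saved adjacencies
-- decide two cases: n = 4s, where n² ≤ 4ns alone is no contradiction, and K₃,₃ with one bar per
-- vertex, where 9 + 4 > 12. In the construction every pair of non-extra vertices is classified by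
-- its index difference i - j modulo M. The vertices A, B spend q + 2 bars and the vertices C, D
-- spend p + 2; taking q = p or q = p - 1, with or without the extra vertices, reaches the four
-- residues of n modulo 4. The obstacle is that the index pattern is cyclic while the blocks follow
-- one another on a line. The last block cannot hand its bars over to block 0, and the exceptional
-- entries (the columns `first` and `last`, the bars that persist in the last block, the odd places
-- of D p and of the last C) repair this cut.

data Phase : Set where
  before during after : Phase

data _⊑_ : Phase → Phase → Set where
  ⊑-refl        : ∀ {φ} → φ ⊑ φ
  before⊑during : before ⊑ during
  before⊑after  : before ⊑ after
  during⊑after  : during ⊑ after

-- Bichromatic adjacencies of a cyclic stack under starts and ends of bars

module _ {X Y : Set} where

  edge : X ⊎ Y → X ⊎ Y → List (X × Y)
  edge (inj₁ x) (inj₂ y) = (x , y) ∷ []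
  edge (inj₂ y) (inj₁ x) = (x , y) ∷ []
  edge (inj₁ _) (inj₁ _) = []
  edge (inj₂ _) (inj₂ _) = []

  edge-comm : ∀ u v → edge u v ≡ edge v u
  edge-comm (inj₁ _) (inj₁ _) = refl
  edge-comm (inj₁ _) (inj₂ _) = refl
  edge-comm (inj₂ _) (inj₁ _) = refl
  edge-comm (inj₂ _) (inj₂ _) = refl

  edge-self : ∀ u → edge u u ≡ []
  edge-self (inj₁ _) = refl
  edge-self (inj₂ _) = refl

  ∣edge∣ : X ⊎ Y → X ⊎ Y → ℕ
  ∣edge∣ u v = length (edge u v)

  ∣edge∣≤1 : ∀ u v → ∣edge∣ u v ≤ 1
  ∣edge∣≤1 (inj₁ _) (inj₁ _) = z≤n
  ∣edge∣≤1 (inj₁ _) (inj₂ _) = ≤-refl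
  ∣edge∣≤1 (inj₂ _) (inj₁ _) = ≤-refl
  ∣edge∣≤1 (inj₂ _) (inj₂ _) = z≤n

  no-triangle : ∀ u v w → ∣edge∣ u v + ∣edge∣ w u + ∣edge∣ w v ≤ 2
  no-triangle (inj₁ _) (inj₁ _) (inj₁ _) = z≤n
  no-triangle (inj₁ _) (inj₁ _) (inj₂ _) = ≤-refl
  no-triangle (inj₁ _) (inj₂ _) (inj₁ _) = ≤-refl
  no-triangle (inj₁ _) (inj₂ _) (inj₂ _) = ≤-refl
  no-triangle (inj₂ _) (inj₁ _) (inj₁ _) = ≤-refl
  no-triangle (inj₂ _) (inj₁ _) (inj₂ _) = ≤-refl
  no-triangle (inj₂ _) (inj₂ _) (inj₁ _) = ≤-refl
  no-triangle (inj₂ _) (inj₂ _) (inj₂ _) = z≤n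

  path : X ⊎ Y → List (X ⊎ Y) → X ⊎ Y → List (X × Y)
  path u []       w = edge u w
  path u (v ∷ vs) w = edge u v ++ path v vs w

  -- A stack of one bar contributes nothing, since `edge v v` is empty; a stack of two lists its
  -- only adjacency twice.
  cycle : List (X ⊎ Y) → List (X × Y)
  cycle []       = []
  cycle (v ∷ vs) = path v vs v

  path-++ : ∀ u us v vs w → path u (us ++ v ∷ vs) w ≡ path u us v ++ path v vs w
  path-++ u []        v vs w = refl
  path-++ u (u′ ∷ us) v vs w =
    trans (cong (edge u u′ ++_) (path-++ u′ us v vs w)) (sym (++-assoc (edge u u′) _ _))

  cycle-rotate : ∀ us vs → cycle (us ++ vs) ↭ cycle (vs ++ us)
  cycle-rotate []       vs       = ↭-reflexive (cong cycle (sym (++-identityʳ vs)))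
  cycle-rotate (u ∷ us) []       = ↭-reflexive (cong cycle (++-identityʳ (u ∷ us)))
  cycle-rotate (u ∷ us) (v ∷ vs) =
    ↭-trans (↭-reflexive (path-++ u us v vs u))
      (↭-trans (++-comm (path u us v) (path v vs u)) (↭-reflexive (sym (path-++ v vs u us v))))

  edge⊆cycle : ∀ us v w ws → edge v w ⊆ cycle (us ++ v ∷ w ∷ ws)
  edge⊆cycle us v w ws =
    ∈-resp-↭ (cycle-rotate (v ∷ w ∷ ws) us) ∘ xs⊆xs++ys (edge v w) (path w (ws ++ us) v)

  final : X ⊎ Y → List (X ⊎ Y) → X ⊎ Y
  final u []       = u
  final u (v ∷ vs) = final v vs

  interior : X ⊎ Y → List (X ⊎ Y) → List (X × Y)
  interior u []       = []
  interior u (v ∷ vs) = edge u v ++ interior v vs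

  path-split : ∀ u us w → path u us w ≡ interior u us ++ edge (final u us) w
  path-split u []       w = refl
  path-split u (v ∷ vs) w =
    trans (cong (edge u v ++_) (path-split v vs w)) (sym (++-assoc (edge u v) _ _))

  -- The number of adjacencies saved so far; before the third insertion it depends on the number of
  -- insertions only, later on the stack.
  lateSlack : List (X ⊎ Y) → ℕ
  lateSlack []              = 4
  lateSlack (_ ∷ [])        = 3
  lateSlack (u ∷ v ∷ [])    = 2 + ∣edge∣ u v
  lateSlack (_ ∷ _ ∷ _ ∷ _) = 2

  slack : ℕ → List (X ⊎ Y) → ℕ
  slack 0                   _  = 0
  slack 1                   _  = 1
  slack 2                   _  = 2
  slack (suc (suc (suc _))) vs = lateSlack vs

  lateSlack-rotate : ∀ us vs → lateSlack (us ++ vs) ≡ lateSlack (vs ++ us)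
  lateSlack-rotate []                vs                = cong lateSlack (sym (++-identityʳ vs))
  lateSlack-rotate us@(_ ∷ _)        []                = cong lateSlack (++-identityʳ us)
  lateSlack-rotate (u ∷ [])          (v ∷ [])          = cong (λ es → 2 + length es) (edge-comm u v)
  lateSlack-rotate (u ∷ [])          (v ∷ w ∷ [])      = refl
  lateSlack-rotate (u ∷ [])          (v ∷ w ∷ _ ∷ vs)  = refl
  lateSlack-rotate (u ∷ w ∷ [])      (v ∷ [])          = refl
  lateSlack-rotate (u ∷ w ∷ _ ∷ _)   (v ∷ [])          = refl
  lateSlack-rotate (u ∷ u′ ∷ [])     (v ∷ w ∷ [])      = refl
  lateSlack-rotate (u ∷ u′ ∷ _ ∷ _)  (v ∷ w ∷ [])      = refl
  lateSlack-rotate (u ∷ u′ ∷ [])     (v ∷ w ∷ _ ∷ _)   = refl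
  lateSlack-rotate (u ∷ u′ ∷ _ ∷ _)  (v ∷ w ∷ _ ∷ _)   = refl

  slack-rotate : ∀ i us vs → slack i (us ++ vs) ≡ slack i (vs ++ us)
  slack-rotate 0                   us vs = refl
  slack-rotate 1                   us vs = refl
  slack-rotate 2                   us vs = refl
  slack-rotate (suc (suc (suc _))) us vs = lateSlack-rotate us vs

  -- L lists the adjacencies met so far, i counts insertions and k all events.  The inequality is
  -- length L + slack ≤ k + b/2, doubled.
  record Swept (L : List (X × Y)) (i k : ℕ) (vs : List (X ⊎ Y)) : Set where
    constructor swept
    field
      covers : cycle vs ⊆ L
      bound  : 2 * (length L + slack i vs) ≤ 2 * k + length (cycle vs)
      small  : length vs ≤ i

  -- Nothing in the invariant depends on where the cycle is cut, so `insert` and `delete` have to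
  -- treat only events at the head of the stack.
  Swept-rotate : ∀ {L i k} us vs → Swept L i k (us ++ vs) → Swept L i k (vs ++ us)
  Swept-rotate {L} {i} {k} us vs (swept c b s) = record
    { covers = c ∘ ∈-resp-↭ (cycle-rotate vs us)
    ; bound  = subst₂ _≤_ (cong (λ s → 2 * (length L + s)) (slack-rotate i us vs))
                          (cong (2 * k +_) (↭-length (cycle-rotate us vs))) b
    ; small  = subst (_≤ i) (trans (length-++ us) (trans (+-comm (length us) _) (sym (length-++ vs)))) s
    }

  Extension : (L : List (X × Y)) (i k : ℕ) (vs : List (X ⊎ Y)) → Set
  Extension L i k vs = Σ[ L′ ∈ List (X × Y) ] L ⊆ L′ × Swept L′ i k vs

  insertSlack : ∀ i u v w us → 2 + length us ≤ i →
    slack (suc i) (u ∷ v ∷ w ∷ us) ≤ slack i (v ∷ w ∷ us)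
  insertSlack (suc (suc zero))    u v w []       _ = ≤-refl
  insertSlack (suc (suc (suc i))) u v w []       _ = m≤m+n 2 _
  insertSlack (suc (suc (suc i))) u v w (_ ∷ us) _ = ≤-refl
  insertSlack (suc (suc zero))    u v w (_ ∷ us) (s≤s (s≤s ()))
  insertSlack (suc zero) u v w us (s≤s ())

  -- The account of one event: new adjacencies plus gained slack are at most 1 + Δb/2. It is
  -- doubled, and the old b is moved to the left, to stay within ℕ.
  bound-step : ∀ n s {k c} n′ s′ k′ c′ → 2 * (n + s) ≤ 2 * k + c →
    2 * (n′ + s′) + c ≤ 2 * (n + s) + 2 + c′ → k′ ≡ suc k →
    2 * (n′ + s′) ≤ 2 * k′ + c′
  bound-step n s {k} {c} n′ s′ k′ c′ b d refl = +-cancelʳ-≤ c _ _ (begin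
    2 * (n′ + s′) + c      ≤⟨ d ⟩
    2 * (n + s) + 2 + c′   ≤⟨ +-monoˡ-≤ c′ (+-monoˡ-≤ 2 b) ⟩
    2 * k + c + 2 + c′     ≡⟨ lemma k c c′ ⟩
    2 * suc k + c′ + c     ∎)
    where
    open ≤-Reasoning
    lemma : ∀ k c c′ → 2 * k + c + 2 + c′ ≡ 2 * suc k + c′ + c
    lemma = solve-∀

  -- With at least two bars present, u comes between z and v, which replaces the adjacency zv by zu
  -- and uv; zu + uv ≤ 1 + (zu + uv - zv)/2 is `no-triangle`. An insertion into a stack of at most
  -- one bar saves an adjacency: into the empty stack it creates none, and beside a single bar b
  -- grows by twice the one it creates.
  insert : ∀ {L i k vs} u → Swept L i k vs → Extension L (suc i) (suc k) (u ∷ vs)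
  insert {L} {i} {k} {[]} u (swept c b s) = L , ⊆-refl , swept
    (λ e → ⊥-elim (none e))
    (bound-step (length L) (slack i []) (length L) (slack (suc i) (u ∷ [])) (suc k) _ b
       (≤-trans (≤-reflexive (+-identityʳ _)) (≤-trans (gain i)
         (m≤m+n (2 * (length L + slack i []) + 2) _))) refl)
    (s≤s z≤n)
    where
    none : ∀ {e} → e ∈ edge u u → ⊥
    none {e} p rewrite edge-self u with p
    ... | ()
    lem : ∀ a b → 2 * (a + suc b) ≡ 2 * (a + b) + 2
    lem = solve-∀
    le : ∀ i → slack (suc i) (u ∷ []) ≤ suc (slack i [])
    le 0 = ≤-refl
    le 1 = ≤-refl
    le 2 = ≤-refl
    le (suc (suc (suc _))) = m≤m+n 3 2
    gain : ∀ i → 2 * (length L + slack (suc i) (u ∷ [])) ≤ 2 * (length L + slack i []) + 2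
    gain i = ≤-trans (*-monoʳ-≤ 2 (+-monoʳ-≤ (length L) (le i))) (≤-reflexive (lem (length L) (slack i [])))
  insert {L} {i} {k} {v ∷ []} u (swept c b s) = edge u v ++ L , xs⊆ys++xs L _ , swept
    ([ xs⊆xs++ys _ L , xs⊆xs++ys _ L ∘ subst (_ ∈_) (edge-comm v u) ]′ ∘ ∈-++⁻ (edge u v))
    (bound-step (length L) (slack i (v ∷ [])) (length (edge u v ++ L)) (slack (suc i) (u ∷ v ∷ [])) (suc k) _ b step refl)
    (s≤s s)
    where
    le : ∀ i → 1 ≤ i → slack (suc i) (u ∷ v ∷ []) ≤ suc (slack i (v ∷ []))
    le 1 _ = ≤-refl
    le 2 _ = +-monoʳ-≤ 2 (∣edge∣≤1 u v)
    le (suc (suc (suc _))) _ = ≤-trans (+-monoʳ-≤ 2 (∣edge∣≤1 u v)) (m≤m+n 3 1)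
    lem : ∀ a b s → 2 * ((a + b) + suc s) + 0 ≡ 2 * (b + s) + 2 + (a + a)
    lem = solve-∀
    open ≤-Reasoning
    step : 2 * (length (edge u v ++ L) + slack (suc i) (u ∷ v ∷ [])) + length (edge v v)
         ≤ 2 * (length L + slack i (v ∷ [])) + 2 + length (edge u v ++ edge v u)
    step = begin
      2 * (length (edge u v ++ L) + slack (suc i) (u ∷ v ∷ [])) + length (edge v v)
        ≡⟨ cong₂ (λ m n → 2 * (m + slack (suc i) (u ∷ v ∷ [])) + n) (length-++ (edge u v)) (cong length (edge-self v)) ⟩
      2 * ((∣edge∣ u v + length L) + slack (suc i) (u ∷ v ∷ [])) + 0
        ≤⟨ +-monoˡ-≤ 0 (*-monoʳ-≤ 2 (+-monoʳ-≤ (∣edge∣ u v + length L) (le i s))) ⟩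
      2 * ((∣edge∣ u v + length L) + suc (slack i (v ∷ []))) + 0
        ≡⟨ lem (∣edge∣ u v) (length L) (slack i (v ∷ [])) ⟩
      2 * (length L + slack i (v ∷ [])) + 2 + (∣edge∣ u v + ∣edge∣ u v)
        ≡⟨ cong (2 * (length L + slack i (v ∷ [])) + 2 +_)
             (trans (cong (λ es → ∣edge∣ u v + length es) (edge-comm u v)) (sym (length-++ (edge u v)))) ⟩
      2 * (length L + slack i (v ∷ [])) + 2 + length (edge u v ++ edge v u) ∎
  insert {L} {i} {k} {v ∷ w ∷ vs} u (swept c b s) = L′ , ⊆L′ , swept
    cov
    (bound-step (length L) (slack i (v ∷ w ∷ vs)) (length L′) (slack (suc i) (u ∷ v ∷ w ∷ vs)) (suc k) _ b step refl)
    (s≤s s)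
    where
    z = final w vs
    -- Pairs met earlier are listed again; the length of `L` only has to bound the number of
    -- distinct pairs from above.
    L′ = edge u v ++ edge z u ++ L
    ⊆L′ : L ⊆ L′
    ⊆L′ = xs⊆ys++xs _ (edge u v) ∘ xs⊆ys++xs L (edge z u)
    old : cycle (v ∷ w ∷ vs) ≡ interior v (w ∷ vs) ++ edge z v
    old = path-split v (w ∷ vs) v
    new : cycle (u ∷ v ∷ w ∷ vs) ≡ edge u v ++ interior v (w ∷ vs) ++ edge z u
    new = cong (edge u v ++_) (path-split v (w ∷ vs) u)
    cov : cycle (u ∷ v ∷ w ∷ vs) ⊆ L′
    cov p with ∈-++⁻ (edge u v) (subst (_ ∈_) new p)
    ... | inj₁ q = xs⊆xs++ys _ _ q
    ... | inj₂ q with ∈-++⁻ (interior v (w ∷ vs)) q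
    ... | inj₁ r = ⊆L′ (c (subst (_ ∈_) (sym old) (xs⊆xs++ys _ _ r)))
    ... | inj₂ r = xs⊆ys++xs _ (edge u v) (xs⊆xs++ys _ L r)
    lenL′ : length L′ ≡ ∣edge∣ u v + (∣edge∣ z u + length L)
    lenL′ = trans (length-++ (edge u v)) (cong (∣edge∣ u v +_) (length-++ (edge z u)))
    lenOld : length (cycle (v ∷ w ∷ vs)) ≡ length (interior v (w ∷ vs)) + ∣edge∣ z v
    lenOld = trans (cong length old) (length-++ (interior v (w ∷ vs)))
    lenNew : length (cycle (u ∷ v ∷ w ∷ vs)) ≡ ∣edge∣ u v + (length (interior v (w ∷ vs)) + ∣edge∣ z u)
    lenNew = trans (cong length new) (trans (length-++ (edge u v)) (cong (∣edge∣ u v +_) (length-++ (interior v (w ∷ vs)))))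
    lem : ∀ a b c l s m → 2 * ((a + (b + l)) + s) + (m + c) ≡ 2 * (l + s) + (a + b + c) + (a + (m + b))
    lem = solve-∀
    open ≤-Reasoning
    step : 2 * (length L′ + slack (suc i) (u ∷ v ∷ w ∷ vs)) + length (cycle (v ∷ w ∷ vs))
         ≤ 2 * (length L + slack i (v ∷ w ∷ vs)) + 2 + length (cycle (u ∷ v ∷ w ∷ vs))
    step = begin
      2 * (length L′ + slack (suc i) (u ∷ v ∷ w ∷ vs)) + length (cycle (v ∷ w ∷ vs))
        ≤⟨ +-monoˡ-≤ _ (*-monoʳ-≤ 2 (+-monoʳ-≤ (length L′) (insertSlack i u v w vs s))) ⟩
      2 * (length L′ + slack i (v ∷ w ∷ vs)) + length (cycle (v ∷ w ∷ vs))
        ≡⟨ cong₂ (λ m n → 2 * (m + slack i (v ∷ w ∷ vs)) + n) lenL′ lenOld ⟩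
      2 * ((∣edge∣ u v + (∣edge∣ z u + length L)) + slack i (v ∷ w ∷ vs)) + (length (interior v (w ∷ vs)) + ∣edge∣ z v)
        ≡⟨ lem (∣edge∣ u v) (∣edge∣ z u) (∣edge∣ z v) (length L) (slack i (v ∷ w ∷ vs)) (length (interior v (w ∷ vs))) ⟩
      2 * (length L + slack i (v ∷ w ∷ vs)) + (∣edge∣ u v + ∣edge∣ z u + ∣edge∣ z v) + (∣edge∣ u v + (length (interior v (w ∷ vs)) + ∣edge∣ z u))
        ≤⟨ +-monoˡ-≤ _ (+-monoʳ-≤ (2 * (length L + slack i (v ∷ w ∷ vs))) (no-triangle u v z)) ⟩
      2 * (length L + slack i (v ∷ w ∷ vs)) + 2 + (∣edge∣ u v + (length (interior v (w ∷ vs)) + ∣edge∣ z u))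
        ≡⟨ cong (2 * (length L + slack i (v ∷ w ∷ vs)) + 2 +_) (sym lenNew) ⟩
      2 * (length L + slack i (v ∷ w ∷ vs)) + 2 + length (cycle (u ∷ v ∷ w ∷ vs)) ∎

  deleteSlack : ∀ i u v w x vs → slack i (v ∷ w ∷ x ∷ vs) ≡ slack i (u ∷ v ∷ w ∷ x ∷ vs)
  deleteSlack 0                   u v w x vs = refl
  deleteSlack 1                   u v w x vs = refl
  deleteSlack 2                   u v w x vs = refl
  deleteSlack (suc (suc (suc _))) u v w x vs = refl

  -- In a stack of at least four bars only zv is created, and the account is again `no-triangle`.
  -- Below that nothing is created, because in a cycle of three all pairs are already adjacent. If e
  -- counts the adjacency of the last two bars, the steps from three bars to none save e, 1 - e and
  -- 1, hence two altogether.
  delete : ∀ {L i k vs} u → Swept L i k (u ∷ vs) → Extension L i (suc k) vs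
  delete {L} {i} {k} {[]} u (swept c b s) = L , ⊆-refl , swept
    (λ ())
    (bound-step (length L) (slack i (u ∷ [])) (length L) (slack i []) (suc k) 0 b step refl)
    z≤n
    where
    le : ∀ i → slack i [] ≤ suc (slack i (u ∷ []))
    le 0 = z≤n
    le 1 = m≤n+m 1 1
    le 2 = m≤n+m 2 1
    le (suc (suc (suc _))) = ≤-refl
    lem : ∀ a b → 2 * (a + suc b) + 0 ≡ 2 * (a + b) + 2 + 0
    lem = solve-∀
    open ≤-Reasoning
    step : 2 * (length L + slack i []) + length (edge u u) ≤ 2 * (length L + slack i (u ∷ [])) + 2 + 0
    step = begin
      2 * (length L + slack i []) + length (edge u u)    ≡⟨ cong (λ es → 2 * (length L + slack i []) + length es) (edge-self u) ⟩
      2 * (length L + slack i []) + 0                    ≤⟨ +-monoˡ-≤ 0 (*-monoʳ-≤ 2 (+-monoʳ-≤ (length L) (le i))) ⟩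
      2 * (length L + suc (slack i (u ∷ []))) + 0        ≡⟨ lem (length L) (slack i (u ∷ [])) ⟩
      2 * (length L + slack i (u ∷ [])) + 2 + 0          ∎
  delete {L} {i} {k} {v ∷ []} u (swept c b s) = L , ⊆-refl , swept
    (λ {e} e∈ → ⊥-elim (none (subst (e ∈_) (edge-self v) e∈)))
    (bound-step (length L) (slack i (u ∷ v ∷ [])) (length L) (slack i (v ∷ [])) (suc k) _ b step refl)
    (≤-trans (n≤1+n 1) s)
    where
    none : ∀ {e : X × Y} → e ∈ [] → ⊥
    none ()
    le : ∀ i → slack i (v ∷ []) + ∣edge∣ u v ≤ suc (slack i (u ∷ v ∷ []))
    le 0 = ∣edge∣≤1 u v
    le 1 = s≤s (∣edge∣≤1 u v)
    le 2 = s≤s (s≤s (∣edge∣≤1 u v))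
    le (suc (suc (suc _))) = ≤-refl
    lem : ∀ a l s → 2 * (l + s) + (a + a) ≡ 2 * (l + (s + a))
    lem = solve-∀
    lem′ : ∀ l s → 2 * (l + suc s) ≡ 2 * (l + s) + 2 + 0
    lem′ = solve-∀
    open ≤-Reasoning
    step : 2 * (length L + slack i (v ∷ [])) + length (edge u v ++ edge v u)
         ≤ 2 * (length L + slack i (u ∷ v ∷ [])) + 2 + length (edge v v)
    step = begin
      2 * (length L + slack i (v ∷ [])) + length (edge u v ++ edge v u)
        ≡⟨ cong (2 * (length L + slack i (v ∷ [])) +_)
             (trans (length-++ (edge u v)) (cong (λ es → ∣edge∣ u v + length es) (edge-comm v u))) ⟩
      2 * (length L + slack i (v ∷ [])) + (∣edge∣ u v + ∣edge∣ u v)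
        ≡⟨ lem (∣edge∣ u v) (length L) (slack i (v ∷ [])) ⟩
      2 * (length L + (slack i (v ∷ []) + ∣edge∣ u v))
        ≤⟨ *-monoʳ-≤ 2 (+-monoʳ-≤ (length L) (le i)) ⟩
      2 * (length L + suc (slack i (u ∷ v ∷ [])))
        ≡⟨ lem′ (length L) (slack i (u ∷ v ∷ [])) ⟩
      2 * (length L + slack i (u ∷ v ∷ [])) + 2 + 0
        ≡⟨ cong (λ es → 2 * (length L + slack i (u ∷ v ∷ [])) + 2 + length es) (sym (edge-self v)) ⟩
      2 * (length L + slack i (u ∷ v ∷ [])) + 2 + length (edge v v) ∎
  delete {L} {i} {k} {v ∷ w ∷ []} u (swept c b s) = L , ⊆-refl , swept
    ([ vw , vw ∘ subst (_ ∈_) (edge-comm w v) ]′ ∘ ∈-++⁻ (edge v w))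
    (bound-step (length L) (slack i (u ∷ v ∷ w ∷ [])) (length L) (slack i (v ∷ w ∷ [])) (suc k) _ b step refl)
    (≤-trans (n≤1+n 2) s)
    where
    vw : edge v w ⊆ L
    vw = c ∘ xs⊆ys++xs _ (edge u v) ∘ xs⊆xs++ys _ (edge w u)
    le : ∀ i → slack i (v ∷ w ∷ []) ≤ slack i (u ∷ v ∷ w ∷ []) + ∣edge∣ w v
    le 0 = z≤n
    le 1 = m≤m+n 1 _
    le 2 = m≤m+n 2 _
    le (suc (suc (suc _))) = ≤-reflexive (cong (λ es → 2 + length es) (edge-comm v w))
    lem : ∀ a b c l s → 2 * (l + (s + c)) + (a + (c + b)) ≡ 2 * (l + s) + (a + b + c) + (c + c)
    lem = solve-∀
    open ≤-Reasoning
    old : length (edge u v ++ edge v w ++ edge w u) ≡ ∣edge∣ u v + (∣edge∣ w v + ∣edge∣ w u)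
    old = trans (length-++ (edge u v)) (cong (∣edge∣ u v +_)
            (trans (length-++ (edge v w)) (cong (λ es → length es + ∣edge∣ w u) (edge-comm v w))))
    new : ∣edge∣ w v + ∣edge∣ w v ≡ length (edge v w ++ edge w v)
    new = trans (cong (λ es → length es + ∣edge∣ w v) (edge-comm w v)) (sym (length-++ (edge v w)))
    step : 2 * (length L + slack i (v ∷ w ∷ [])) + length (edge u v ++ edge v w ++ edge w u)
         ≤ 2 * (length L + slack i (u ∷ v ∷ w ∷ [])) + 2 + length (edge v w ++ edge w v)
    step = begin
      2 * (length L + slack i (v ∷ w ∷ [])) + length (edge u v ++ edge v w ++ edge w u)
        ≤⟨ +-mono-≤ (*-monoʳ-≤ 2 (+-monoʳ-≤ (length L) (le i))) (≤-reflexive old) ⟩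
      2 * (length L + (slack i (u ∷ v ∷ w ∷ []) + ∣edge∣ w v)) + (∣edge∣ u v + (∣edge∣ w v + ∣edge∣ w u))
        ≡⟨ lem (∣edge∣ u v) (∣edge∣ w u) (∣edge∣ w v) (length L) (slack i (u ∷ v ∷ w ∷ [])) ⟩
      2 * (length L + slack i (u ∷ v ∷ w ∷ [])) + (∣edge∣ u v + ∣edge∣ w u + ∣edge∣ w v) + (∣edge∣ w v + ∣edge∣ w v)
        ≤⟨ +-mono-≤ (+-monoʳ-≤ (2 * (length L + slack i (u ∷ v ∷ w ∷ []))) (no-triangle u v w)) (≤-reflexive new) ⟩
      2 * (length L + slack i (u ∷ v ∷ w ∷ [])) + 2 + length (edge v w ++ edge w v) ∎
  delete {L} {i} {k} {v ∷ w ∷ x ∷ vs} u (swept c b s) = L′ , ⊆L′ , swept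
    cov
    (bound-step (length L) (slack i (u ∷ v ∷ w ∷ x ∷ vs)) (length L′) (slack i (v ∷ w ∷ x ∷ vs)) (suc k) _ b step refl)
    (≤-trans (n≤1+n _) s)
    where
    us = w ∷ x ∷ vs
    z = final v us
    L′ = edge z v ++ L
    ⊆L′ : L ⊆ L′
    ⊆L′ = xs⊆ys++xs L (edge z v)
    old : cycle (u ∷ v ∷ us) ≡ edge u v ++ interior v us ++ edge z u
    old = cong (edge u v ++_) (path-split v us u)
    new : cycle (v ∷ us) ≡ interior v us ++ edge z v
    new = path-split v us v
    cov : cycle (v ∷ us) ⊆ L′
    cov p with ∈-++⁻ (interior v us) (subst (_ ∈_) new p)
    ... | inj₁ q = ⊆L′ (c (subst (_ ∈_) (sym old) (xs⊆ys++xs _ (edge u v) (xs⊆xs++ys _ _ q))))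
    ... | inj₂ q = xs⊆xs++ys _ L q
    lenOld : length (cycle (u ∷ v ∷ us)) ≡ ∣edge∣ u v + (length (interior v us) + ∣edge∣ z u)
    lenOld = trans (cong length old) (trans (length-++ (edge u v)) (cong (∣edge∣ u v +_) (length-++ (interior v us))))
    lenNew : length (cycle (v ∷ us)) ≡ length (interior v us) + ∣edge∣ z v
    lenNew = trans (cong length new) (length-++ (interior v us))
    lem : ∀ a b c l s m → 2 * ((c + l) + s) + (a + (m + b)) ≡ 2 * (l + s) + (a + b + c) + (m + c)
    lem = solve-∀
    open ≤-Reasoning
    step : 2 * (length L′ + slack i (v ∷ us)) + length (cycle (u ∷ v ∷ us))
         ≤ 2 * (length L + slack i (u ∷ v ∷ us)) + 2 + length (cycle (v ∷ us))
    step = begin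
      2 * (length L′ + slack i (v ∷ us)) + length (cycle (u ∷ v ∷ us))
        ≡⟨ cong₂ (λ m n → 2 * m + n) (cong₂ _+_ (length-++ (edge z v)) (deleteSlack i u v w x vs)) lenOld ⟩
      2 * ((∣edge∣ z v + length L) + slack i (u ∷ v ∷ us)) + (∣edge∣ u v + (length (interior v us) + ∣edge∣ z u))
        ≡⟨ lem (∣edge∣ u v) (∣edge∣ z u) (∣edge∣ z v) (length L) (slack i (u ∷ v ∷ us)) (length (interior v us)) ⟩
      2 * (length L + slack i (u ∷ v ∷ us)) + (∣edge∣ u v + ∣edge∣ z u + ∣edge∣ z v) + (length (interior v us) + ∣edge∣ z v)
        ≤⟨ +-mono-≤ (+-monoʳ-≤ (2 * (length L + slack i (u ∷ v ∷ us))) (no-triangle u v z)) (≤-reflexive (sym lenNew)) ⟩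
      2 * (length L + slack i (u ∷ v ∷ us)) + 2 + length (cycle (v ∷ us)) ∎

  rotateExtension : ∀ {L i k} us vs → Extension L i k (us ++ vs) → Extension L i k (vs ++ us)
  rotateExtension us vs (L′ , inc , σ) = L′ , inc , Swept-rotate us vs σ

  insertAt : ∀ {L i k} us v vs → Swept L i k (us ++ vs) → Extension L (suc i) (suc k) (us ++ v ∷ vs)
  insertAt us v vs σ = rotateExtension (v ∷ vs) us (insert v (Swept-rotate us vs σ))

  deleteAt : ∀ {L i k} us v vs → Swept L i k (us ++ v ∷ vs) → Extension L i (suc k) (us ++ vs)
  deleteAt us v vs σ = rotateExtension vs us (delete v (Swept-rotate us (v ∷ vs) σ))

  -- All bars in a fixed vertical order, including those not met at present, so that a start or an
  -- end changes one phase and never the order.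
  State : Set
  State = List ((X ⊎ Y) × Phase)

  stack : State → List (X ⊎ Y)
  stack []                 = []
  stack ((v , before) ∷ S) = stack S
  stack ((v , during) ∷ S) = v ∷ stack S
  stack ((v , after)  ∷ S) = stack S

  started : State → ℕ
  started []                 = 0
  started ((v , before) ∷ S) = started S
  started ((v , during) ∷ S) = suc (started S)
  started ((v , after)  ∷ S) = suc (started S)

  events : State → ℕ
  events []                 = 0
  events ((v , before) ∷ S) = events S
  events ((v , during) ∷ S) = suc (events S)
  events ((v , after)  ∷ S) = suc (suc (events S))

  stack-++ : ∀ S S′ → stack (S ++ S′) ≡ stack S ++ stack S′
  stack-++ []                 S′ = refl
  stack-++ ((v , before) ∷ S) S′ = stack-++ S S′
  stack-++ ((v , during) ∷ S) S′ = cong (v ∷_) (stack-++ S S′)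
  stack-++ ((v , after)  ∷ S) S′ = stack-++ S S′

  started-++ : ∀ S S′ → started (S ++ S′) ≡ started S + started S′
  started-++ []                 S′ = refl
  started-++ ((v , before) ∷ S) S′ = started-++ S S′
  started-++ ((v , during) ∷ S) S′ = cong suc (started-++ S S′)
  started-++ ((v , after)  ∷ S) S′ = cong suc (started-++ S S′)

  events-++ : ∀ S S′ → events (S ++ S′) ≡ events S + events S′
  events-++ []                 S′ = refl
  events-++ ((v , before) ∷ S) S′ = events-++ S S′
  events-++ ((v , during) ∷ S) S′ = cong suc (events-++ S S′)
  events-++ ((v , after)  ∷ S) S′ = cong (2 +_) (events-++ S S′)

  SweptTo : List (X × Y) → State → Set
  SweptTo L S = Swept L (started S) (events S) (stack S)

  ExtensionTo : List (X × Y) → State → Set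
  ExtensionTo L S = Σ[ L′ ∈ List (X × Y) ] L ⊆ L′ × SweptTo L′ S

  reindex : ∀ {L i i′ k k′ vs vs′} → i ≡ i′ → k ≡ k′ → vs ≡ vs′ → Swept L i k vs → Swept L i′ k′ vs′
  reindex refl refl refl σ = σ

  start : ∀ {L} S v S′ → SweptTo L (S ++ (v , before) ∷ S′) → ExtensionTo L (S ++ (v , during) ∷ S′)
  start S v S′ σ
    with L′ , inc , τ ← insertAt (stack S) v (stack S′) (reindex (started-++ S _) (events-++ S _) (stack-++ S _) σ)
    = L′ , inc , reindex
        (trans (sym (+-suc (started S) _)) (sym (started-++ S _)))
        (trans (sym (+-suc (events S) _)) (sym (events-++ S _)))
        (sym (stack-++ S _)) τ

  finish : ∀ {L} S v S′ → SweptTo L (S ++ (v , during) ∷ S′) → ExtensionTo L (S ++ (v , after) ∷ S′)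
  finish S v S′ σ
    with L′ , inc , τ ← deleteAt (stack S) v (stack S′) (reindex (started-++ S _) (events-++ S _) (stack-++ S _) σ)
    = L′ , inc , reindex
        (sym (started-++ S _))
        (trans (sym (+-suc (events S) _)) (sym (events-++ S _)))
        (sym (stack-++ S _)) τ

  advanceOne : ∀ {L} S v {φ ψ} S′ → φ ⊑ ψ → SweptTo L (S ++ (v , φ) ∷ S′) → ExtensionTo L (S ++ (v , ψ) ∷ S′)
  advanceOne S v S′ ⊑-refl        σ = _ , ⊆-refl , σ
  advanceOne S v S′ before⊑during σ = start S v S′ σ
  advanceOne S v S′ during⊑after  σ = finish S v S′ σ
  advanceOne S v S′ before⊑after  σ
    with L′ , inc , τ ← start S v S′ σ
    with L″ , inc′ , υ ← finish S v S′ τ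
    = L″ , inc′ ∘ inc , υ

  module _ {B : Set} (label : B → X ⊎ Y) where

    at : (B → Phase) → List B → State
    at f = map (λ b → label b , f b)

    -- The bars change phase in their vertical order and not in the order of their endpoints. The
    -- stacks passed on the way need not occur in the layout: they can only add pairs to the list,
    -- while the number of events stays the same.
    advance : ∀ {L} {f g : B → Phase} → (∀ b → f b ⊑ g b) → ∀ S bs →
      SweptTo L (S ++ at f bs) → ExtensionTo L (S ++ at g bs)
    advance f⊑g S []       σ = _ , ⊆-refl , σ
    advance {f = f} {g} f⊑g S (b ∷ bs) σ
      with L′ , inc , τ ← advanceOne S (label b) (at f bs) (f⊑g b) σ
      with L″ , inc′ , υ ← advance f⊑g (S ++ (label b , g b) ∷ []) bs
             (subst (SweptTo L′) (sym (++-assoc S _ _)) τ)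
      = L″ , inc′ ∘ inc , subst (SweptTo L″) (++-assoc S _ _) υ

-- Counting in lists, and sweeping a vertical line across bars

unique-⊆⇒length≤ : ∀ {A : Set} {xs ys : List A} → Unique xs → xs ⊆ ys → length xs ≤ length ys
unique-⊆⇒length≤ {xs = []} [] _ = z≤n
unique-⊆⇒length≤ {xs = x ∷ xs} {ys} (x∉xs ∷ xs!) inc
  with us , vs , refl ← ∈-∃++ (inc (here refl))
  = ≤-trans (s≤s (unique-⊆⇒length≤ xs! inc′)) (≤-reflexive (sym (↭-length (shift x us vs))))
  where
  inc′ : xs ⊆ us ++ vs
  inc′ p with ∈-resp-↭ (shift x us vs) (inc (there p))
  ... | here refl = contradiction refl (All.lookup x∉xs p)
  ... | there q   = q

map-unique : ∀ {A B : Set} {f : A → B} {xs} → Unique xs → (∀ {x y} → x ∈ xs → y ∈ xs → f x ≡ f y → x ≡ y) → Unique (map f xs)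
map-unique []          _   = []
map-unique (x∉ ∷ xs!) inj =
  All.map⁺ (All.tabulate λ y∈ eq → All.lookup x∉ y∈ (inj (here refl) (there y∈) eq))
  ∷ map-unique xs! (λ x∈ y∈ → inj (there x∈) (there y∈))

between : ∀ {A : Set} {R : A → A → Set} {xs : List A} {x y} →
  AllPairs R xs → x ∈ xs → y ∈ xs → x ≢ y → ¬ R y x →
  Σ[ us ∈ List A ] Σ[ vs ∈ List A ] Σ[ ws ∈ List A ]
    xs ≡ us ++ x ∷ vs ++ y ∷ ws × All (R x) vs × All (λ v → R v y) vs
between (_ ∷ _)      (here refl) (here refl) x≢y _ = contradiction refl x≢y
between {R = R} (Rx ∷ Rxs) (here refl) (there y∈) _ _
  with vs , ws , refl ← ∈-∃++ y∈
  = [] , vs , ws , refl , All.++⁻ˡ vs Rx , before-y vs Rxs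
  where
  before-y : ∀ vs {y ws} → AllPairs R (vs ++ y ∷ ws) → All (λ v → R v y) vs
  before-y []       _          = []
  before-y (v ∷ vs) (Rv ∷ Rvs) = All.head (All.++⁻ʳ vs Rv) ∷ before-y vs Rvs
between (Ry ∷ _)     (there x∈) (here refl) _   ¬Ryx = contradiction (All.lookup Ry x∈) ¬Ryx
between (_ ∷ Rxs)    (there x∈) (there y∈) x≢y ¬Ryx
  with us , vs , ws , refl , p , q ← between Rxs x∈ y∈ x≢y ¬Ryx
  = _ ∷ us , vs , ws , refl , p , q

-- The condition for `during` is half-open, l ≤ x < r: a bar present at the left end of a channel of
-- positive width then reaches into the channel and can block it.
phase : ℚ → Bar → Phase
phase x b with x ℚ.<? l b | x ℚ.<? r b
... | yes _ | _     = before
... | no _  | yes _ = during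
... | no _  | no _  = after

phase-mono : ∀ {x x′} b → x ℚ.≤ x′ → phase x b ⊑ phase x′ b
phase-mono {x} {x′} b x≤x′ with x ℚ.<? l b | x ℚ.<? r b | x′ ℚ.<? l b | x′ ℚ.<? r b
... | yes _ | _     | yes _  | _      = ⊑-refl
... | yes _ | _     | no _   | yes _  = before⊑during
... | yes _ | _     | no _   | no _   = before⊑after
... | no p  | _     | yes p′ | _      = contradiction (ℚ.≤-<-trans x≤x′ p′) p
... | no _  | yes _ | no _   | yes _  = ⊑-refl
... | no _  | yes _ | no _   | no _   = during⊑after
... | no _  | no p  | no _   | yes p′ = contradiction (ℚ.≤-<-trans x≤x′ p′) p
... | no _  | no _  | no _   | no _   = ⊑-refl

⊑-after : ∀ φ → φ ⊑ after
⊑-after before = before⊑after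
⊑-after during = during⊑after
⊑-after after  = ⊑-refl

before⊑ : ∀ φ → before ⊑ φ
before⊑ before = ⊑-refl
before⊑ during = before⊑during
before⊑ after  = before⊑after

phase-during : ∀ {x} b → ¬ x ℚ.< l b → x ℚ.< r b → phase x b ≡ during
phase-during {x} b p q with x ℚ.<? l b | x ℚ.<? r b
... | yes p′ | _     = contradiction p′ p
... | no _   | yes _ = refl
... | no _   | no q′ = contradiction q q′

during-phase : ∀ {x} b → phase x b ≡ during → ¬ x ℚ.< l b × x ℚ.< r b
during-phase {x} b eq with x ℚ.<? l b | x ℚ.<? r b
during-phase b () | yes _ | _
during-phase b eq | no p  | yes q = p , q
during-phase b () | no _  | no _

module _ {X Y B : Set} (label : B → X ⊎ Y) where

  private
    at′ : (B → Phase) → List B → State {X} {Y}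
    at′ = at label

  at-before : ∀ bs → SweptTo [] (at′ (λ _ → before) bs)
  at-before bs = reindex (sym (started₀ bs)) (sym (events₀ bs)) (sym (stack₀ bs)) (swept (λ ()) z≤n z≤n)
    where
    started₀ : ∀ bs → started (at′ (λ _ → before) bs) ≡ 0
    started₀ []       = refl
    started₀ (b ∷ bs) = started₀ bs
    events₀ : ∀ bs → events (at′ (λ _ → before) bs) ≡ 0
    events₀ []       = refl
    events₀ (b ∷ bs) = events₀ bs
    stack₀ : ∀ bs → stack (at′ (λ _ → before) bs) ≡ []
    stack₀ []       = refl
    stack₀ (b ∷ bs) = stack₀ bs

  started-after : ∀ bs → started (at′ (λ _ → after) bs) ≡ length bs
  started-after []       = refl
  started-after (b ∷ bs) = cong suc (started-after bs)

  events-after : ∀ bs → events (at′ (λ _ → after) bs) ≡ length bs + length bs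
  events-after []       = refl
  events-after (b ∷ bs) = cong suc (trans (cong suc (events-after bs)) (sym (+-suc (length bs) _)))

  stack-after : ∀ bs → stack (at′ (λ _ → after) bs) ≡ []
  stack-after []       = refl
  stack-after (b ∷ bs) = stack-after bs

  -- The sweep runs from all bars `before` to all bars `after` and so spends two events per bar,
  -- whichever positions are sampled in between.
  sweep : (body : B → Bar) (bs : List B) (xs : List ℚ) → AllPairs ℚ._≤_ xs →
    Σ[ L ∈ List (X × Y) ] Swept L (length bs) (length bs + length bs) [] ×
      All (λ x → cycle (stack (at′ (phase x ∘ body) bs)) ⊆ L) xs
  sweep body bs xs sorted =
    let L , _ , σ , cs = from xs (λ _ → before) (at-before bs) sorted (All.universal (λ _ _ → before⊑ _) xs) in L , σ , cs
    where
    from : ∀ {L} xs f → SweptTo L (at′ f bs) → AllPairs ℚ._≤_ xs → All (λ x → ∀ b → f b ⊑ phase x (body b)) xs →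
      Σ[ L′ ∈ List (X × Y) ] L ⊆ L′ × Swept L′ (length bs) (length bs + length bs) [] ×
        All (λ x → cycle (stack (at′ (phase x ∘ body) bs)) ⊆ L′) xs
    from [] f σ _ _
      with L′ , inc , τ ← advance label {f = f} {g = λ _ → after} (⊑-after ∘ f) [] bs σ
      = L′ , inc , reindex (started-after bs) (events-after bs) (stack-after bs) τ , []
    from (x ∷ xs) f σ (x≤ ∷ sorted) (f⊑ ∷ _)
      with L′ , inc , τ ← advance label {f = f} {g = phase x ∘ body} f⊑ [] bs σ
      with L″ , inc′ , υ , cs ← from xs (phase x ∘ body) τ sorted (All.map (λ x≤x′ b → phase-mono (body b) x≤x′) x≤)
      = L″ , inc′ ∘ inc , υ , (inc′ ∘ Swept.covers τ) ∷ cs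

  stack-none : ∀ {f : B → Phase} {bs} → All (λ b → f b ≢ during) bs → stack (at′ f bs) ≡ []
  stack-none [] = refl
  stack-none {f} {b ∷ bs} (p ∷ ps) with f b
  ... | before = stack-none ps
  ... | during = contradiction refl p
  ... | after  = stack-none ps

  stack-adjacent : ∀ {f : B → Phase} us b vs c ws → f b ≡ during → f c ≡ during → All (λ d → f d ≢ during) vs →
    Σ[ ss ∈ _ ] Σ[ ts ∈ _ ] stack (at′ f (us ++ b ∷ vs ++ c ∷ ws)) ≡ ss ++ label b ∷ label c ∷ ts
  stack-adjacent {f} us b vs c ws fb fc none = stack (at′ f us) , stack (at′ f ws) , (begin
    stack (at′ f (us ++ b ∷ vs ++ c ∷ ws))          ≡⟨ split us _ ⟩
    stack (at′ f us) ++ stack (at′ f (b ∷ vs ++ c ∷ ws))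
      ≡⟨ cong (stack (at′ f us) ++_) (on b _ fb) ⟩
    stack (at′ f us) ++ label b ∷ stack (at′ f (vs ++ c ∷ ws))
      ≡⟨ cong (λ ss → stack (at′ f us) ++ label b ∷ ss) (split vs _) ⟩
    stack (at′ f us) ++ label b ∷ stack (at′ f vs) ++ stack (at′ f (c ∷ ws))
      ≡⟨ cong₂ (λ ss ts → stack (at′ f us) ++ label b ∷ ss ++ ts) (stack-none none) (on c _ fc) ⟩
    stack (at′ f us) ++ label b ∷ label c ∷ stack (at′ f ws) ∎)
    where
    open ≡-Reasoning
    split : ∀ us vs → stack (at′ f (us ++ vs)) ≡ stack (at′ f us) ++ stack (at′ f vs)
    split us vs = trans (cong stack (map-++ _ us vs)) (stack-++ (at′ f us) _)
    on : ∀ b bs → f b ≡ during → stack (at′ f (b ∷ bs)) ≡ label b ∷ stack (at′ f bs)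
    on b bs eq rewrite eq = refl

length-allFin : ∀ n → length (allFin n) ≡ n
length-allFin n = length-tabulate {n = n} (λ i → i)

length-pairs : ∀ {A B : Set} (xs : List A) (ys : List B) → length (cartesianProduct xs ys) ≡ length xs * length ys
length-pairs []       ys = refl
length-pairs (x ∷ xs) ys = trans (length-++ (map (x ,_) ys)) (cong₂ _+_ (length-map _ ys) (length-pairs xs ys))

ℚ-≤∧≢⇒< : ∀ {p q} → p ℚ.≤ q → p ≢ q → p ℚ.< q
ℚ-≤∧≢⇒< p≤q p≢q = ℚ.≰⇒> (p≢q ∘ ℚ.≤-antisym p≤q)

length-concatMap≤ : ∀ {A B : Set} (f : A → List B) {t} → (∀ x → length (f x) ≤ t) → ∀ xs →
  length (concatMap f xs) ≤ length xs * t
length-concatMap≤ f le []       = z≤n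
length-concatMap≤ f le (x ∷ xs) =
  ≤-trans (≤-reflexive (length-++ (f x))) (+-mono-≤ (le x) (length-concatMap≤ f le xs))

-- The adjacency count for a layout of the complete bipartite graph

module _ {n t : ℕ} (R : BarRep (K n) t) where
  open BarRep R

  private
    Vx = Fin n ⊎ Fin n
    Ix = BarIx bars
    bar′ = barAt bars

    vertices : List Vx
    vertices = map inj₁ (allFin n) ++ map inj₂ (allFin n)

    slots : Vx → List Ix
    slots v = map (v ,_) (allFin (length (bars v)))

    indices : List Ix
    indices = concatMap slots vertices

    ∈-vertices : ∀ v → v ∈ vertices
    ∈-vertices (inj₁ i) = ∈-++⁺ˡ (∈-map⁺ inj₁ (∈-allFin i))
    ∈-vertices (inj₂ j) = ∈-++⁺ʳ (map inj₁ (allFin n)) (∈-map⁺ inj₂ (∈-allFin j))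

    vertices-unique : Unique vertices
    vertices-unique = Unique.++⁺ (Unique.map⁺ inj₁-injective (Unique.allFin⁺ n)) (Unique.map⁺ inj₂-injective (Unique.allFin⁺ n))
      λ (p , q) → apart (∈-map⁻ inj₁ p) (∈-map⁻ inj₂ q)
      where
      apart : ∀ {v} → ∃[ i ] i ∈ allFin n × v ≡ inj₁ i → ∃[ j ] j ∈ allFin n × v ≡ inj₂ j → ⊥
      apart (_ , _ , refl) (_ , _ , ())

    ∈-indices : ∀ p → p ∈ indices
    ∈-indices (v , k) = ∈-concat⁺′ (∈-map⁺ (v ,_) (∈-allFin k)) (∈-map⁺ slots (∈-vertices v))

    indices-unique : Unique indices
    indices-unique = Unique.concat⁺
      (All.map⁺ (All.universal (λ v → Unique.map⁺ (λ { refl → refl }) (Unique.allFin⁺ _)) vertices))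
      (AllPairs.map⁺ (AllPairs.map disjoint′ vertices-unique))
      where
      disjoint′ : ∀ {v w} → v ≢ w → ∀ {p} → p ∈ slots v × p ∈ slots w → ⊥
      disjoint′ v≢w (p , q) with ∈-map⁻ _ p | ∈-map⁻ _ q
      ... | _ , _ , refl | _ , _ , eq = v≢w (cong proj₁ eq)

    indices-length : length indices ≤ (n + n) * t
    indices-length = ≤-trans
      (length-concatMap≤ slots (λ v → ≤-trans (≤-reflexive (trans (length-map {A = Fin (length (bars v))} {B = Ix} (v ,_) (allFin (length (bars v)))) (length-allFin (length (bars v))))) (atMost v)) vertices)
      (≤-reflexive (cong (_* t) (trans (length-++ (map inj₁ (allFin n)))
        (cong₂ _+_ (trans (length-map inj₁ (allFin n)) (length-allFin n))
                   (trans (length-map inj₂ (allFin n)) (length-allFin n))))))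

    byHeight = On.decTotalOrder ℚ.≤-decTotalOrder (y ∘ bar′)
    module SortIx = Sort byHeight
    module SortX = Sort ℚ.≤-decTotalOrder

    ordered : List Ix
    ordered = SortIx.sort indices

    ∈-ordered : ∀ p → p ∈ ordered
    ∈-ordered p = ∈-resp-↭ (↭-sym (SortIx.sort-↭ indices)) (∈-indices p)

    _≼_ : Ix → Ix → Set
    p ≼ q = y (bar′ p) ℚ.≤ y (bar′ q) × p ≢ q

    ordered-≼ : AllPairs _≼_ ordered
    ordered-≼ = AllPairs.zip
      ( Linked⇒AllPairs (λ {p} {q} {s} → ℚ.≤-trans) (SortIx.sort-↗ indices)
      , Permₛ.Unique-resp-↭ (setoid Ix) (↭⇒↭ₛ (↭-sym (SortIx.sort-↭ indices))) indices-unique )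

    -- At equal height `disjoint` would separate the bars, yet both contain the abscissa a. This
    -- removes the ties left by sorting, since `MeetsInterior` asks for strict inequalities of
    -- heights.
    level : ∀ {b d a a′} → a ℚ.< a′ → ¬ a ℚ.< l (bar′ b) → ¬ r (bar′ b) ℚ.< a′ → ¬ a ℚ.< l (bar′ d) → a ℚ.< r (bar′ d) →
      b ≢ d → y (bar′ b) ≢ y (bar′ d)
    level {b} {d} a<a′ ¬a<lb ¬rb<a′ ¬a<ld a<rd b≢d with disjoint b d b≢d
    ... | inj₁ y≢        = y≢
    ... | inj₂ (inj₁ lt) = contradiction (ℚ.<-trans (ℚ.<-≤-trans a<a′ (ℚ.≮⇒≥ ¬rb<a′)) lt) ¬a<ld
    ... | inj₂ (inj₂ lt) = contradiction (ℚ.<-trans a<rd lt) ¬a<lb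

    inactive : ∀ {p q} (s : SeesUp bar′ (bar′ p) (bar′ q)) {d} → p ≼ d × d ≼ q → phase (proj₁ (proj₂ s)) (bar′ d) ≢ during
    inactive {p} {q} (_ , a , a′ , a<a′ , ¬a<lp , ¬rp<a′ , ¬a<lq , ¬rq<a′ , clear) {d} ((yp≤yd , p≢d) , (yd≤yq , d≢q)) eq
      with during-phase (bar′ d) eq
    ... | ¬a<ld , a<rd = clear d
      ( ℚ-≤∧≢⇒< yp≤yd (level {p} {d} a<a′ ¬a<lp ¬rp<a′ ¬a<ld a<rd p≢d)
      , ℚ-≤∧≢⇒< yd≤yq (level {q} {d} a<a′ ¬a<lq ¬rq<a′ ¬a<ld a<rd (d≢q ∘ sym) ∘ sym)
      , ℚ.≤-<-trans (ℚ.≮⇒≥ ¬a<ld) a<a′ , a<rd )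

    -- The left end of the channel serves as sample: p and q are present there and no bar sorted
    -- between them is, so they are neighbours in the stack.
    seen : ∀ {p q} (s : SeesUp bar′ (bar′ p) (bar′ q)) →
      edge (proj₁ p) (proj₁ q) ⊆ cycle (stack (at proj₁ (phase (proj₁ (proj₂ s)) ∘ bar′) ordered))
    seen {p} {q} s@(yp<yq , a , a′ , a<a′ , ¬a<lp , ¬rp<a′ , ¬a<lq , ¬rq<a′ , _)
      with us , vs , ws , eq , p≼ , ≼q ← between ordered-≼ (∈-ordered p) (∈-ordered q)
             (λ { refl → ℚ.<-irrefl refl yp<yq }) (λ (yq≤yp , _) → ℚ.<-irrefl refl (ℚ.<-≤-trans yp<yq yq≤yp))
      with ss , ts , eq′ ← stack-adjacent proj₁ us p vs q ws
             (phase-during (bar′ p) ¬a<lp (ℚ.<-≤-trans a<a′ (ℚ.≮⇒≥ ¬rp<a′)))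
             (phase-during (bar′ q) ¬a<lq (ℚ.<-≤-trans a<a′ (ℚ.≮⇒≥ ¬rq<a′)))
             (All.map (inactive {p} {q} s) (All.zip (p≼ , ≼q)))
      = subst (λ ss → edge (proj₁ p) (proj₁ q) ⊆ cycle ss)
          (sym (trans (cong (stack ∘ at proj₁ (phase a ∘ bar′)) eq) eq′))
          (edge⊆cycle ss (proj₁ p) (proj₁ q) ts)

    channel : (e : Fin n × Fin n) → Σ[ x ∈ ℚ ] e ∈ cycle (stack (at proj₁ (phase x ∘ bar′) ordered))
    channel (i , j) with Equivalence.to (adjacency (inj₁ i) (inj₂ j) (λ ())) tt
    ... | k , m , inj₁ s = proj₁ (proj₂ s) , seen {inj₁ i , k} {inj₂ j , m} s (here refl)
    ... | k , m , inj₂ s = proj₁ (proj₂ s) , seen {inj₂ j , m} {inj₁ i , k} s (here refl)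

    pairs : List (Fin n × Fin n)
    pairs = cartesianProduct (allFin n) (allFin n)

    times : List ℚ
    times = map (proj₁ ∘ channel) pairs

    swept-pairs : Σ[ L ∈ List (Fin n × Fin n) ] pairs ⊆ L × Swept L (length indices) (length indices + length indices) []
    swept-pairs
      with L , σ , cs ← sweep proj₁ bar′ ordered (SortX.sort times)
             (Linked⇒AllPairs ℚ.≤-trans (SortX.sort-↗ times))
      = L , (λ {e} e∈ → All.lookup cs (∈-resp-↭ (↭-sym (SortX.sort-↭ times)) (∈-map⁺ (proj₁ ∘ channel) e∈)) (proj₂ (channel e)))
      , subst (λ N → Swept L N (N + N) []) (↭-length (SortIx.sort-↭ indices)) σ

    pairs-length : length pairs ≡ n * n
    pairs-length = trans (length-pairs (allFin n) (allFin n)) (cong₂ _*_ (length-allFin n) (length-allFin n))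

  -- The n² pairs are distinct members of `L`, and at the end of the sweep the stack is empty, so b
  -- = 0. The final slack is 4 only after a third insertion, hence the separate weaker estimate for
  -- fewer bars.
  edge-bound : Σ[ N ∈ ℕ ] N ≤ (n + n) * t × n * n ≤ N + N × (3 ≤ N → n * n + 4 ≤ N + N)
  edge-bound with L , inc , swept _ b _ ← swept-pairs
    = N , indices-length
    , ≤-trans n²≤L (≤-trans (m≤m+n (length L) _) half)
    , λ 3≤N → ≤-trans (+-mono-≤ n²≤L (≤-reflexive (sym (late N 3≤N)))) half
    where
    N = length indices
    n²≤L : n * n ≤ length L
    n²≤L = subst (_≤ length L) pairs-length
      (unique-⊆⇒length≤ (Unique.cartesianProduct⁺ (Unique.allFin⁺ n) (Unique.allFin⁺ n)) inc)
    half : length L + slack {Fin n} {Fin n} N [] ≤ N + N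
    half = *-cancelˡ-≤ 2 (subst (2 * (length L + slack {Fin n} {Fin n} N []) ≤_) (+-identityʳ _) b)
    late : ∀ N → 3 ≤ N → slack {Fin n} {Fin n} N [] ≡ 4
    late (suc (suc (suc _))) _ = refl
    late (suc zero) (s≤s ())
    late (suc (suc zero)) (s≤s (s≤s ()))

-- List positions and integer coordinates

_!_ : ∀ {A : Set} → List A → ℕ → Maybe A
[]       ! _     = nothing
(x ∷ xs) ! zero  = just x
(x ∷ xs) ! suc i = xs ! i

!-bound : ∀ {A : Set} (xs : List A) i {x} → xs ! i ≡ just x → i < length xs
!-bound (x ∷ xs) zero    _  = s≤s z≤n
!-bound (x ∷ xs) (suc i) eq = s≤s (!-bound xs i eq)

!-∈ : ∀ {A : Set} (xs : List A) i {x} → xs ! i ≡ just x → x ∈ xs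
!-∈ (x ∷ xs) zero    refl = here refl
!-∈ (x ∷ xs) (suc i) eq   = there (!-∈ xs i eq)

∈-! : ∀ {A : Set} {x : A} {xs} → x ∈ xs → ∃[ i ] xs ! i ≡ just x
∈-! (here refl) = 0 , refl
∈-! (there x∈) with i , eq ← ∈-! x∈ = suc i , eq

!-unique : ∀ {A : Set} {xs : List A} → Unique xs → ∀ i j {x} → xs ! i ≡ just x → xs ! j ≡ just x → i ≡ j
!-unique (_ ∷ _)   zero    zero    _    _    = refl
!-unique (x∉ ∷ _)  zero    (suc j) refl eq   = contradiction refl (All.lookup x∉ (!-∈ _ j eq))
!-unique (x∉ ∷ _)  (suc i) zero    eq   refl = contradiction refl (All.lookup x∉ (!-∈ _ i eq))
!-unique (_ ∷ xs!) (suc i) (suc j) eq   eq′  = cong suc (!-unique xs! i j eq eq′)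

!-linked : ∀ {A : Set} {R : A → A → Set} {xs} → Linked R xs → ∀ i {x y} → xs ! i ≡ just x → xs ! suc i ≡ just y → R x y
!-linked (Rxy ∷ _)  zero    refl refl = Rxy
!-linked (_ ∷ Rxs)  (suc i) eq   eq′  = !-linked Rxs i eq eq′

abstract
  ι : ℕ → ℚ
  ι n = mkℚ (ℤ.+ n) 0 (Coprime.sym (1-coprimeTo n))

  ι-mono-< : ∀ {m n} → m < n → ι m ℚ.< ι n
  ι-mono-< {m} {n} m<n = ℚ.*<* (subst₂ ℤ._<_ (sym (ℤ.*-identityʳ (ℤ.+ m))) (sym (ℤ.*-identityʳ (ℤ.+ n))) (ℤ.+<+ m<n))

  ι-mono-≤ : ∀ {m n} → m ≤ n → ι m ℚ.≤ ι n
  ι-mono-≤ {m} {n} m≤n = ℚ.*≤* (subst₂ ℤ._≤_ (sym (ℤ.*-identityʳ (ℤ.+ m))) (sym (ℤ.*-identityʳ (ℤ.+ n))) (ℤ.+≤+ m≤n))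

ι-cancel-< : ∀ {m n} → ι m ℚ.< ι n → m < n
ι-cancel-< {m} {n} lt with m <? n
... | yes m<n = m<n
... | no m≮n  = contradiction (ℚ.<-≤-trans lt (ι-mono-≤ (≮⇒≥ m≮n))) (ℚ.<-irrefl refl)

≤⇒≮ᵠ : ∀ {p q} → p ℚ.≤ q → ¬ q ℚ.< p
≤⇒≮ᵠ p≤q q<p = ℚ.<-irrefl refl (ℚ.≤-<-trans p≤q q<p)

ι-injective : ∀ {m n} → ι m ≡ ι n → m ≡ n
ι-injective {m} {n} eq with <-cmp m n
... | tri< lt _ _ = contradiction (ι-mono-< lt) (ℚ.<-irrefl eq)
... | tri≈ _ e _  = e
... | tri> _ _ gt = contradiction (ι-mono-< gt) (ℚ.<-irrefl (sym eq))

floor : ∀ {a} m n → ι m ℚ.≤ a → a ℚ.< ι n → Σ[ c ∈ ℕ ] ι c ℚ.≤ a × a ℚ.< ι (suc c)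
floor {a} m zero    m≤a a<0 = contradiction (ℚ.≤-<-trans (ℚ.≤-trans (ι-mono-≤ z≤n) m≤a) a<0) (ℚ.<-irrefl refl)
floor {a} m (suc n) m≤a a<n with a ℚ.<? ι n
... | yes a<n′ = floor m n m≤a a<n′
... | no a≮n′  = n , ℚ.≮⇒≥ a≮n′ , a<n

lookup-unique : ∀ {A : Set} {xs : List A} → Unique xs → ∀ {i j} → lookup xs i ≡ lookup xs j → i ≡ j
lookup-unique (_ ∷ _)   {zero}  {zero}  _  = refl
lookup-unique (x∉ ∷ _)  {zero}  {suc j} eq = contradiction eq (All.lookup x∉ (∈-lookup j))
lookup-unique (x∉ ∷ _)  {suc i} {zero}  eq = contradiction (sym eq) (All.lookup x∉ (∈-lookup i))
lookup-unique (_ ∷ xs!) {suc i} {suc j} eq = cong suc (lookup-unique xs! eq)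

∈⇒lookup : ∀ {A : Set} {x : A} {xs} → x ∈ xs → Σ[ i ∈ Fin (length xs) ] lookup xs i ≡ x
∈⇒lookup p = Any.index p , sym (Any.lookup-index p)

-- From cell diagrams to bar layouts

Opposite : ∀ {L : Set} → L ⊎ L → L ⊎ L → Set
Opposite (inj₁ _) (inj₁ _) = ⊥
Opposite (inj₁ _) (inj₂ _) = ⊤
Opposite (inj₂ _) (inj₁ _) = ⊤
Opposite (inj₂ _) (inj₂ _) = ⊥

-- cell r c is the label of row r, counted from below, over the interval [c , c + 1]; the bars are the
-- maximal runs of equal labels in a row.
module Cells {L : Set} (_≟ᴸ_ : DecidableEquality L) (H W : ℕ) (cell : ℕ → ℕ → Maybe (L ⊎ L)) where

  _≟ᶜ_ : DecidableEquality (Maybe (L ⊎ L))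
  _≟ᶜ_ = Maybe.≡-dec (Sum.≡-dec _≟ᴸ_ _≟ᴸ_)

  IsStart : L ⊎ L → ℕ × ℕ → Set
  IsStart v (r , c) = cell r c ≡ just v × (∀ {c′} → c′ < c → c ≡ suc c′ → cell r c′ ≢ just v)

  isStart? : ∀ v p → Dec (IsStart v p)
  isStart? v (r , zero) with cell r zero ≟ᶜ just v
  ... | yes eq = yes (eq , λ ())
  ... | no neq = no (neq ∘ proj₁)
  isStart? v (r , suc c) with cell r (suc c) ≟ᶜ just v | cell r c ≟ᶜ just v
  ... | yes eq | no neq = yes (eq , λ { _ refl → neq })
  ... | yes eq | yes eq′ = no λ (_ , f) → f ≤-refl refl eq′
  ... | no neq | _ = no (neq ∘ proj₁)

  starts : L ⊎ L → List (ℕ × ℕ)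
  starts v = filter (isStart? v) (cartesianProduct (upTo H) (upTo W))

  starts-unique : ∀ v → Unique (starts v)
  starts-unique v = Unique.filter⁺ (isStart? v) (Unique.cartesianProduct⁺ (Unique.upTo⁺ H) (Unique.upTo⁺ W))

  isStart : ∀ {v p} → p ∈ starts v → IsStart v p
  isStart p∈ = proj₂ (∈-filter⁻ (isStart? _) {xs = cartesianProduct (upTo H) (upTo W)} p∈)

  Empty : ℕ → ℕ → ℕ → Set
  Empty r₁ r₂ c = ∀ {r} → r < r₂ → r₁ < r → cell r c ≡ nothing

  record Stacked (r₁ r₂ c : ℕ) (u v : L ⊎ L) : Set where
    constructor stacked
    field
      below : r₁ < r₂
      lower : cell r₁ c ≡ just u
      upper : cell r₂ c ≡ just v
      empty : Empty r₁ r₂ c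

  module Bars
    (inside : ∀ {r c v} → cell r c ≡ just v → r < H × c < W)
    (alternating : ∀ {r₁ r₂ c u v} → Stacked r₁ r₂ c u v → Opposite u v)
    (covering : ∀ i j → ∃[ r₁ ] ∃[ r₂ ] ∃[ c ] (Stacked r₁ r₂ c (inj₁ i) (inj₂ j) ⊎ Stacked r₁ r₂ c (inj₂ j) (inj₁ i)))
    {t : ℕ} (few : ∀ v → length (starts v) ≤ t)
    where

    -- The last argument is fuel; W is enough, because no cell in column W or beyond is filled.
    run : ℕ → L ⊎ L → ℕ → ℕ → ℕ
    run r v c zero    = 0
    run r v c (suc k) with cell r c ≟ᶜ just v
    ... | yes _ = suc (run r v (suc c) k)
    ... | no _  = 0

    run-all : ∀ {r v} c k {c′} → c ≤ c′ → c′ < c + run r v c k → cell r c′ ≡ just v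
    run-all c zero    c≤c′ c′< = contradiction (<-≤-trans c′< (≤-trans (≤-reflexive (+-identityʳ c)) c≤c′)) (n≮n _)
    run-all {r} {v} c (suc k) {c′} c≤c′ c′< with cell r c ≟ᶜ just v
    ... | no _ = contradiction (<-≤-trans c′< (≤-trans (≤-reflexive (+-identityʳ c)) c≤c′)) (n≮n _)
    ... | yes eq with c ≟ c′
    ...   | yes refl = eq
    ...   | no c≢c′  = run-all (suc c) k (≤∧≢⇒< c≤c′ c≢c′) (<-≤-trans c′< (≤-reflexive (+-suc c _)))

    run-max : ∀ {r v} c k → W ≤ c + k → cell r (c + run r v c k) ≢ just v
    run-max c zero    W≤ eq = contradiction (proj₂ (inside eq)) (≤⇒≯ W≤)
    run-max {r} {v} c (suc k) W≤ eq with cell r c ≟ᶜ just v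
    ... | yes _  = run-max (suc c) k (≤-trans W≤ (≤-reflexive (+-suc c k))) (trans (cong (cell r) (sym (+-suc c _))) eq)
    ... | no neq = neq (trans (cong (cell r) (sym (+-identityʳ c))) eq)

    end : L ⊎ L → ℕ × ℕ → ℕ
    end v (r , c) = suc c + run r v (suc c) W

    start<end : ∀ v p → proj₂ p < end v p
    start<end v (r , c) = s≤s (m≤m+n c _)

    -- Different heights for all runs, so that consecutive bars of a row may abut without touching.
    height : ℕ × ℕ → ℕ
    height (r , c) = r * W + c

    height-mono : ∀ {r₁ r₂ c₁ c₂} → c₁ < W → r₁ < r₂ → height (r₁ , c₁) < height (r₂ , c₂)
    height-mono {r₁} {r₂} {c₁} {c₂} c₁<W r₁<r₂ = begin-strict
      r₁ * W + c₁   <⟨ +-monoʳ-< (r₁ * W) c₁<W ⟩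
      r₁ * W + W    ≡⟨ +-comm (r₁ * W) W ⟩
      suc r₁ * W    ≤⟨ *-monoˡ-≤ W r₁<r₂ ⟩
      r₂ * W        ≤⟨ m≤m+n _ c₂ ⟩
      r₂ * W + c₂   ∎
      where open ≤-Reasoning

    height-row : ∀ {r₁ r₂ c₁ c₂} → c₂ < W → height (r₁ , c₁) < height (r₂ , c₂) → r₁ ≤ r₂
    height-row {r₁} {r₂} c₂<W lt with r₁ ≤? r₂
    ... | yes le = le
    ... | no nle = contradiction lt (<⇒≯ (height-mono c₂<W (≰⇒> nle)))

    height-injective : ∀ {r₁ r₂ c₁ c₂} → c₁ < W → c₂ < W → height (r₁ , c₁) ≡ height (r₂ , c₂) → (r₁ , c₁) ≡ (r₂ , c₂)
    height-injective {r₁} {r₂} c₁<W c₂<W eq with <-cmp r₁ r₂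
    ... | tri< lt _ _   = contradiction eq (<⇒≢ (height-mono c₁<W lt))
    ... | tri≈ _ refl _ = cong (r₁ ,_) (+-cancelˡ-≡ (r₁ * W) _ _ eq)
    ... | tri> _ _ gt   = contradiction (sym eq) (<⇒≢ (height-mono c₂<W gt))

    toBar : L ⊎ L → ℕ × ℕ → Bar
    toBar v p = bar (ι (height p)) (ι (proj₂ p)) (ι (end v p)) (ι-mono-< (start<end v p))

    Reaches : ℕ → ℕ → L ⊎ L → ℕ → Set
    Reaches r s v c = IsStart v (r , s) × s ≤ c × c < end v (r , s)

    reaches-cell : ∀ {r s v c} → Reaches r s v c → cell r c ≡ just v
    reaches-cell {r} {s} {v} {c} ((eq , _) , s≤c , c<) with s ≟ c
    ... | yes refl = eq
    ... | no s≢c   = run-all (suc s) W (≤∧≢⇒< s≤c s≢c) c<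

    reaching : ∀ {r v} c → cell r c ≡ just v → Σ[ s ∈ ℕ ] Reaches r s v c
    reaching {r} {v} c eq with isStart? v (r , c)
    ... | yes st = c , st , ≤-refl , start<end v (r , c)
    reaching {r} {v} zero eq    | no ¬st = contradiction (eq , λ ()) ¬st
    reaching {r} {v} (suc c) eq | no ¬st with cell r c ≟ᶜ just v
    ... | no neq  = contradiction (eq , λ { _ refl → neq }) ¬st
    ... | yes eq′ with reaching c eq′
    ...   | s , st , s≤c , c< = s , st , m≤n⇒m≤1+n s≤c , ≤∧≢⇒< c<
      (λ e → run-max {r} {v} (suc s) W (m≤n+m W (suc s)) (subst (λ x → cell r x ≡ just v) e eq))

    no-later-start : ∀ {r s s′ v c} → IsStart v (r , s) → Reaches r s′ v c → c < end v (r , s) → ¬ s < s′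
    no-later-start {s′ = suc s′} st ((_ , new) , s′≤c , _) c< (s≤s s≤s′) =
      new ≤-refl refl (reaches-cell (st , s≤s′ , <-trans s′≤c c<))

    reaches-unique : ∀ {r s s′ v v′ c} → Reaches r s v c → Reaches r s′ v′ c → s ≡ s′ × v ≡ v′
    reaches-unique {s = s} {s′} ρ@(st , _ , c<) ρ′@(st′ , _ , c<′)
      with refl ← just-injective (trans (sym (reaches-cell ρ)) (reaches-cell ρ′))
      with <-cmp s s′
    ... | tri< lt _ _   = contradiction lt (no-later-start st ρ′ c<)
    ... | tri≈ _ refl _ = refl , refl
    ... | tri> _ _ gt   = contradiction gt (no-later-start st′ ρ c<′)

    module _ {n : ℕ} (vertex : Fin n ↔ L) where
      private
        V′ = Fin n ⊎ Fin n
        open Inverse vertex using () renaming (to to name; from to unname)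

      label : V′ → L ⊎ L
      label = Sum.map name name

      label-injective : ∀ {u v} → label u ≡ label v → u ≡ v
      label-injective {inj₁ i} {inj₁ j} eq = cong inj₁ (trans (sym (Inverse.strictlyInverseʳ vertex i))
        (trans (cong unname (Sum.inj₁-injective eq)) (Inverse.strictlyInverseʳ vertex j)))
      label-injective {inj₂ i} {inj₂ j} eq = cong inj₂ (trans (sym (Inverse.strictlyInverseʳ vertex i))
        (trans (cong unname (Sum.inj₂-injective eq)) (Inverse.strictlyInverseʳ vertex j)))

      unlabel : ∀ l → Σ[ v ∈ V′ ] label v ≡ l
      unlabel (inj₁ l) = inj₁ (unname l) , cong inj₁ (Inverse.strictlyInverseˡ vertex l)
      unlabel (inj₂ l) = inj₂ (unname l) , cong inj₂ (Inverse.strictlyInverseˡ vertex l)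

      opposite⇒adjacent : ∀ u v → Opposite (label u) (label v) → KAdj u v
      opposite⇒adjacent (inj₁ _) (inj₂ _) _ = tt
      opposite⇒adjacent (inj₂ _) (inj₁ _) _ = tt

      adjacent-sym : ∀ u v → KAdj {n} u v → KAdj v u
      adjacent-sym (inj₁ _) (inj₂ _) _ = tt
      adjacent-sym (inj₂ _) (inj₁ _) _ = tt

      barsOf : V′ → List Bar
      barsOf v = map (toBar (label v)) (starts (label v))

      private
        body = barAt barsOf

      position : ∀ q → Σ[ p ∈ ℕ × ℕ ] IsStart (label (proj₁ q)) p × body q ≡ toBar (label (proj₁ q)) p
      position (v , k) with p , p∈ , eq ← ∈-map⁻ (toBar (label v)) (∈-lookup {xs = barsOf v} k) = p , isStart p∈ , eq

      barOf : ∀ {v p} → IsStart (label v) p → Σ[ k ∈ Fin (length (barsOf v)) ] lookup (barsOf v) k ≡ toBar (label v) p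
      barOf {v} {r , c} st with r<H , c<W ← inside (proj₁ st) =
        ∈⇒lookup (∈-map⁺ (toBar (label v)) (∈-filter⁺ (isStart? (label v)) (∈-cartesianProduct⁺ (∈-upTo⁺ r<H) (∈-upTo⁺ c<W)) st))

      start-column : ∀ {v r c} → IsStart v (r , c) → c < W
      start-column st = proj₂ (inside (proj₁ st))

      toBar-injective : ∀ {v w p q} → IsStart v p → IsStart w q → y (toBar v p) ≡ y (toBar w q) → p ≡ q
      toBar-injective st st′ eq = height-injective (start-column st) (start-column st′) (ι-injective eq)

      barsOf-unique : ∀ v → Unique (barsOf v)
      barsOf-unique v = map-unique (starts-unique (label v))
        (λ p∈ q∈ eq → toBar-injective {label v} {label v} (isStart p∈) (isStart q∈) (cong y eq))

      heights-differ : ∀ p q → p ≢ q → y (body p) ≢ y (body q)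
      heights-differ p@(u , i) q@(v , j) p≢q yeq
        with s , st , eq ← position p | s′ , st′ , eq′ ← position q
        with refl ← toBar-injective st st′ (trans (sym (cong y eq)) (trans yeq (cong y eq′)))
        with refl ← label-injective {u} {v} (just-injective (trans (sym (proj₁ st)) (proj₁ st′)))
        = p≢q (cong (u ,_) (lookup-unique (barsOf-unique u) (trans eq (sym eq′))))

      module _ {r₁ r₂ c : ℕ} {u v : V′} (S : Stacked r₁ r₂ c (label u) (label v)) where
        open Stacked S

        -- The channel is the unit strip over column c. By its height a blocking bar would belong to
        -- a row from r₁ to r₂: in one of these two rows it would be the run that sees or is seen,
        -- strictly between them it would fill a cell that `empty` declares empty.
        sees-stacked : ∃[ i ] ∃[ j ] SeesUp body (lookup (barsOf u) i) (lookup (barsOf v) j)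
        sees-stacked
          with s₁ , ρ₁@(st₁ , s₁≤c , c<₁) ← reaching c lower | s₂ , ρ₂@(st₂ , s₂≤c , c<₂) ← reaching c upper
          with i , eq₁ ← barOf {u} st₁ | j , eq₂ ← barOf {v} st₂
          = i , j , subst₂ (SeesUp body) (sym eq₁) (sym eq₂)
            ( ι-mono-< (height-mono (start-column st₁) below) , ι c , ι (suc c) , ι-mono-< ≤-refl
            , ≤⇒≮ᵠ (ι-mono-≤ s₁≤c) , ≤⇒≮ᵠ (ι-mono-≤ c<₁) , ≤⇒≮ᵠ (ι-mono-≤ s₂≤c) , ≤⇒≮ᵠ (ι-mono-≤ c<₂)
            , λ q → clear ρ₁ ρ₂ (position q) )
          where
          clear : ∀ {s₁ s₂ w b} → Reaches r₁ s₁ (label u) c → Reaches r₂ s₂ (label v) c →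
            (Σ[ p ∈ ℕ × ℕ ] IsStart w p × b ≡ toBar w p) →
            ¬ MeetsInterior b (ι c) (ι (suc c)) (ι (height (r₁ , s₁))) (ι (height (r₂ , s₂)))
          clear {s₁} {s₂} {w} ρ₁ ρ₂ ((r , s) , st , refl) (y₁< , <y₂ , l< , <r)
            with <-cmp r₁ r | <-cmp r r₂
          ... | tri> _ _ gt | _ = contradiction (height-row (start-column st) (ι-cancel-< y₁<)) (<⇒≱ gt)
          ... | _ | tri> _ _ gt = contradiction (height-row (start-column (proj₁ ρ₂)) (ι-cancel-< <y₂)) (<⇒≱ gt)
          ... | tri≈ _ refl _ | _ with refl ← proj₁ (reaches-unique ρ₁ (st , s≤s⁻¹ (ι-cancel-< l<) , ι-cancel-< <r)) = ℚ.<-irrefl refl y₁<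
          ... | _ | tri≈ _ refl _ with refl ← proj₁ (reaches-unique ρ₂ (st , s≤s⁻¹ (ι-cancel-< l<) , ι-cancel-< <r)) = ℚ.<-irrefl refl <y₂
          ... | tri< r₁<r _ _ | tri< r<r₂ _ _
            with () ← trans (sym (empty r<r₂ r₁<r)) (reaches-cell (st , s≤s⁻¹ (ι-cancel-< l<) , ι-cancel-< <r))

      -- A channel may have arbitrary rational ends, but the unit column containing its left end a
      -- represents it: both bars cover this column, and a filled cell between them there would lie
      -- on a run that obstructs the channel.
      sees-opposite : ∀ p q → SeesUp body (body p) (body q) → Opposite (label (proj₁ p)) (label (proj₁ q))
      sees-opposite p q (yp<yq , a , a′ , a<a′ , ¬a<lp , ¬rp<a′ , ¬a<lq , ¬rq<a′ , clear)
        with (r₁ , s₁) , st₁ , eq₁ ← position p | (r₂ , s₂) , st₂ , eq₂ ← position q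
        rewrite eq₁ | eq₂
        with c , c≤a , a<c ← floor s₁ (end (label (proj₁ p)) (r₁ , s₁)) (ℚ.≮⇒≥ ¬a<lp) (ℚ.<-≤-trans a<a′ (ℚ.≮⇒≥ ¬rp<a′))
        = alternating (stacked r₁<r₂ (reaches-cell ρ₁) (reaches-cell ρ₂) emptyᶜ)
        where
        reach : ∀ {v r s} → IsStart v (r , s) → ¬ a ℚ.< ι s → ¬ ι (end v (r , s)) ℚ.< a′ → Reaches r s v c
        reach st ¬a<l ¬r<a′ = st , s≤s⁻¹ (ι-cancel-< (ℚ.≤-<-trans (ℚ.≮⇒≥ ¬a<l) a<c))
          , ι-cancel-< (ℚ.≤-<-trans c≤a (ℚ.<-≤-trans a<a′ (ℚ.≮⇒≥ ¬r<a′)))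
        ρ₁ = reach st₁ ¬a<lp ¬rp<a′
        ρ₂ = reach st₂ ¬a<lq ¬rq<a′
        r₁<r₂ : r₁ < r₂
        r₁<r₂ with m≤n⇒m<n∨m≡n (height-row (start-column st₂) (ι-cancel-< yp<yq))
        ... | inj₁ lt = lt
        ... | inj₂ refl with refl ← proj₁ (reaches-unique ρ₁ ρ₂) = contradiction yp<yq (ℚ.<-irrefl refl)
        emptyᶜ : Empty r₁ r₂ c
        emptyᶜ {r} r<r₂ r₁<r with cell r c in eq
        ... | nothing = refl
        ... | just l
          with s , st , s≤c , c< ← reaching c eq
          with w , refl ← unlabel l
          with k , eqᵏ ← barOf {w} st
          = contradiction
              ( ι-mono-< (height-mono (start-column st₁) r₁<r) , ι-mono-< (height-mono (start-column st) r<r₂)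
              , ℚ.≤-<-trans (ℚ.≤-trans (ι-mono-≤ s≤c) c≤a) a<a′ , ℚ.<-≤-trans a<c (ι-mono-≤ c<) )
              (subst (λ b → ¬ MeetsInterior b a a′ _ _) eqᵏ (clear (w , k)))

      barRep : BarRep (K n) t
      barRep = record
        { bars      = barsOf
        ; atMost    = λ v → ≤-trans (≤-reflexive (length-map _ (starts (label v)))) (few (label v))
        ; disjoint  = λ p q p≢q → inj₁ (heights-differ p q p≢q)
        ; adjacency = λ u v _ → mk⇔ (adjacent⇒sees u v) (λ (i , j , s) → sees⇒adjacent (u , i) (v , j) s)
        }
        where
        sees⇒adjacent : ∀ p q → Sees body (body p) (body q) → KAdj (proj₁ p) (proj₁ q)
        sees⇒adjacent p q (inj₁ s) = opposite⇒adjacent (proj₁ p) (proj₁ q) (sees-opposite p q s)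
        sees⇒adjacent p q (inj₂ s) = adjacent-sym (proj₁ q) (proj₁ p) (opposite⇒adjacent (proj₁ q) (proj₁ p) (sees-opposite q p s))
        seen : ∀ u v {r₁ r₂ c} → Stacked r₁ r₂ c (label u) (label v) ⊎ Stacked r₁ r₂ c (label v) (label u) →
          ∃[ i ] ∃[ j ] Sees body (lookup (barsOf u) i) (lookup (barsOf v) j)
        seen u v (inj₁ S) with i , j , s ← sees-stacked {u = u} {v} S = i , j , inj₁ s
        seen u v (inj₂ S) with j , i , s ← sees-stacked {u = v} {u} S = i , j , inj₂ s
        adjacent⇒sees : ∀ u v → KAdj u v → ∃[ i ] ∃[ j ] Sees body (lookup (barsOf u) i) (lookup (barsOf v) j)
        adjacent⇒sees (inj₁ i) (inj₂ j) _ with _ , _ , _ , S ← covering (name i) (name j) = seen (inj₁ i) (inj₂ j) S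
        adjacent⇒sees (inj₂ j) (inj₁ i) _ with _ , _ , _ , S ← covering (name i) (name j) = seen (inj₂ j) (inj₁ i) (Sum.swap S)

-- Diagrams given as a sequence of named columns

-- place v k is the row and column at which the k-th bar of v begins, so no vertex has more than t bars
-- as soon as every run begins at one of its places with k < t.
module Columns {L Col : Set} (_≟ᴸ_ : DecidableEquality L) (H t : ℕ)
  (content : ℕ → Col → Maybe (L ⊎ L)) (place : L ⊎ L → ℕ → ℕ × Col) where

  Placed : L ⊎ L → ℕ → Col → Set
  Placed v r c = ∃[ k ] k < t × place v k ≡ (r , c)

  -- What may happen in a row from one column to the next. Only `new` costs a bar, and it has to
  -- name the place that pays for it; `same` also covers a row that stays empty.
  data Move (r : ℕ) (a b : Col) : Set where
    same : content r b ≡ content r a → Move r a b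
    new  : ∀ v → content r b ≡ just v → Placed v r b → Move r a b
    gone : content r b ≡ nothing → Move r a b

  record Tower (r₁ r₂ : ℕ) (c : Col) (u v : L ⊎ L) : Set where
    constructor tower
    field
      below : r₁ < r₂
      lower : content r₁ c ≡ just u
      upper : content r₂ c ≡ just v
      empty : ∀ {r} → r < r₂ → r₁ < r → content r c ≡ nothing

  module Sequence (first : Col) (rest : List Col)
    (high : ∀ {r c v} → content r c ≡ just v → r < H)
    (alternating : ∀ {r₁ r₂ c u v} → Tower r₁ r₂ c u v → Opposite u v)
    (covering : ∀ i j → ∃[ r₁ ] ∃[ r₂ ] ∃[ c ] c ∈ first ∷ rest × (Tower r₁ r₂ c (inj₁ i) (inj₂ j) ⊎ Tower r₁ r₂ c (inj₂ j) (inj₁ i)))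
    (distinct : Unique (first ∷ rest))
    (initial : ∀ {r v} → content r first ≡ just v → Placed v r first)
    (moves : Linked (λ a b → ∀ r → Move r a b) (first ∷ rest))
    where

    columns : List Col
    columns = first ∷ rest

    cell : ℕ → ℕ → Maybe (L ⊎ L)
    cell r c = (columns ! c) >>= content r

    open Cells _≟ᴸ_ H (length columns) cell

    cell-column : ∀ {r c v} → cell r c ≡ just v → ∃[ col ] columns ! c ≡ just col × content r col ≡ just v
    cell-column {r} {c} eq with columns ! c
    ... | just col = col , refl , eq

    column-cell : ∀ {r} c {col} → columns ! c ≡ just col → cell r c ≡ content r col
    column-cell c eq rewrite eq = refl

    start-placed : ∀ {v r c} → IsStart v (r , c) → ∃[ col ] columns ! c ≡ just col × Placed v r col
    start-placed {v} {r} {zero} (eq , _) = first , refl , initial eq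
    start-placed {v} {r} {suc c} (eq , fresh)
      with b , eqᵇ , eqᵛ ← cell-column {r} {suc c} eq
      with columns ! c in eqᵃ
    ... | nothing = contradiction (trans (sym eqᵃ) (proj₂ (earlier columns c eqᵇ))) (λ ())
      where
      earlier : ∀ {A : Set} (xs : List A) c {b} → xs ! suc c ≡ just b → ∃[ a ] xs ! c ≡ just a
      earlier (x ∷ xs) zero    _  = x , refl
      earlier (x ∷ xs) (suc c) eq = earlier xs c eq
    ... | just a with !-linked moves c eqᵃ eqᵇ r
    ...   | same eqˢ = contradiction (trans (column-cell c eqᵃ) (trans (sym eqˢ) eqᵛ)) (fresh ≤-refl refl)
    ...   | new w eqʷ pl with refl ← just-injective (trans (sym eqʷ) eqᵛ) = b , eqᵇ , pl
    ...   | gone eqⁿ with () ← trans (sym eqⁿ) eqᵛ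

    -- As no column name repeats, a start is determined by its row and the name of its column, and
    -- these pairs lie among the t places of v.
    few : ∀ v → length (starts v) ≤ t
    few v = begin
      length (starts v)                        ≡⟨ length-map site (starts v) ⟨
      length (map site (starts v))             ≤⟨ unique-⊆⇒length≤ sites-unique sites-placed ⟩
      length (map (site′ ∘ place v) (upTo t))  ≡⟨ length-map (site′ ∘ place v) (upTo t) ⟩
      length (upTo t)                          ≡⟨ length-upTo t ⟩
      t                                        ∎
      where
      open ≤-Reasoning
      site : ℕ × ℕ → ℕ × Maybe Col
      site (r , c) = r , columns ! c
      site′ : ℕ × Col → ℕ × Maybe Col
      site′ (r , c) = r , just c
      sites-unique : Unique (map site (starts v))
      sites-unique = map-unique (starts-unique v) inj
        where
        inj : ∀ {p p′} → p ∈ starts v → p′ ∈ starts v → site p ≡ site p′ → p ≡ p′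
        inj {r , c} {r′ , c′} p∈ p′∈ eq
          with col , eqᶜ , _ ← start-placed (isStart p∈)
          with refl ← cong proj₁ eq
          = cong (r ,_) (!-unique distinct c c′ eqᶜ (trans (sym (cong proj₂ eq)) eqᶜ))
      sites-placed : map site (starts v) ⊆ map (site′ ∘ place v) (upTo t)
      sites-placed s∈
        with (r , c) , p∈ , refl ← ∈-map⁻ site s∈
        with col , eqᶜ , k , k<t , eq ← start-placed (isStart p∈)
        = subst (_∈ _) (trans (cong site′ eq) (cong (r ,_) (sym eqᶜ))) (∈-map⁺ (site′ ∘ place v) (∈-upTo⁺ k<t))

    sequence-barRep : ∀ {n} → Fin n ↔ L → BarRep (K n) t
    sequence-barRep = Bars.barRep inside alt cov few
      where
      inside : ∀ {r c v} → cell r c ≡ just v → r < H × c < length columns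
      inside {r} {c} eq with col , eqᶜ , eqᵛ ← cell-column {r} {c} eq = high eqᵛ , !-bound columns c eqᶜ
      alt : ∀ {r₁ r₂ c u v} → Stacked r₁ r₂ c u v → Opposite u v
      alt {r₁} {r₂} {c} (stacked r₁<r₂ lower upper empty)
        with col , eqᶜ , eqᵘ ← cell-column {r₁} {c} lower
        = alternating (tower r₁<r₂ eqᵘ (trans (sym (column-cell c eqᶜ)) upper)
            (λ r<r₂ r₁<r → trans (sym (column-cell c eqᶜ)) (empty r<r₂ r₁<r)))
      restack : ∀ {r₁ r₂ col u v} c → columns ! c ≡ just col → Tower r₁ r₂ col u v → Stacked r₁ r₂ c u v
      restack c eqᶜ (tower r₁<r₂ lower upper empty) = stacked r₁<r₂
        (trans (column-cell c eqᶜ) lower) (trans (column-cell c eqᶜ) upper)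
        (λ r<r₂ r₁<r → trans (column-cell c eqᶜ) (empty r<r₂ r₁<r))
      cov : ∀ i j → ∃[ r₁ ] ∃[ r₂ ] ∃[ c ] (Stacked r₁ r₂ c (inj₁ i) (inj₂ j) ⊎ Stacked r₁ r₂ c (inj₂ j) (inj₁ i))
      cov i j with r₁ , r₂ , col , col∈ , T ← covering i j with c , eqᶜ ← ∈-! col∈ =
        r₁ , r₂ , c , Sum.map (restack c eqᶜ) (restack c eqᶜ) T

-- Explicit tables for n ≤ 5, checked by decision procedures

Opposite? : ∀ {L : Set} (u v : L ⊎ L) → Dec (Opposite u v)
Opposite? (inj₁ _) (inj₁ _) = no λ ()
Opposite? (inj₁ _) (inj₂ _) = yes tt
Opposite? (inj₂ _) (inj₁ _) = yes tt
Opposite? (inj₂ _) (inj₂ _) = no λ ()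

Opposite′ : ∀ {L : Set} → Maybe (L ⊎ L) → Maybe (L ⊎ L) → Set
Opposite′ (just u) (just v) = Opposite u v
Opposite′ _        _        = ⊤

Opposite′? : ∀ {L : Set} (u v : Maybe (L ⊎ L)) → Dec (Opposite′ u v)
Opposite′? (just u) (just v) = Opposite? u v
Opposite′? (just u) nothing  = yes tt
Opposite′? nothing  _        = yes tt

module Table {n H : ℕ} (columns : List (Vec (Fin n ⊎ Fin n) H)) where

  private
    W = length columns

  cell : ℕ → ℕ → Maybe (Fin n ⊎ Fin n)
  cell r c = (columns ! c) >>= λ column → Vec.toList column ! r

  open Cells Fin._≟_ H W cell

  inside : ∀ {r c v} → cell r c ≡ just v → r < H × c < W
  inside {r} {c} eq with columns ! c in eqᶜ
  ... | just column = <-≤-trans (!-bound (Vec.toList column) r eq) (≤-reflexive (Vec.length-toList column)) , !-bound columns c eqᶜ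

  -- The order of the bounded quantifiers is the one that nested uses of `allUpTo?` decide.
  Alternating : Set
  Alternating = ∀ {c} → c < W → ∀ {r₂} → r₂ < H → ∀ {r₁} → r₁ < r₂ →
    Empty r₁ r₂ c → Opposite′ (cell r₁ c) (cell r₂ c)

  empty? : ∀ r₁ r₂ c → Dec (Empty r₁ r₂ c)
  empty? r₁ r₂ c = allUpTo? (λ r → (r₁ <? r) →-dec (cell r c ≟ᶜ nothing)) r₂

  alternating? : Dec Alternating
  alternating? = allUpTo? (λ c → allUpTo? (λ r₂ → allUpTo? (λ r₁ →
    empty? r₁ r₂ c →-dec Opposite′? (cell r₁ c) (cell r₂ c)) r₂) H) W

  Neighbours : Fin n ⊎ Fin n → Fin n ⊎ Fin n → Set
  Neighbours u v = ∃[ c ] c < W × ∃[ r₂ ] r₂ < H × ∃[ r₁ ] r₁ < r₂ ×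
    (cell r₁ c ≡ just u × cell r₂ c ≡ just v × Empty r₁ r₂ c)

  neighbours? : ∀ u v → Dec (Neighbours u v)
  neighbours? u v = anyUpTo? (λ c → anyUpTo? (λ r₂ → anyUpTo? (λ r₁ →
    (cell r₁ c ≟ᶜ just u) ×-dec (cell r₂ c ≟ᶜ just v) ×-dec empty? r₁ r₂ c) r₂) H) W

  Covering : Set
  Covering = ∀ i j → Neighbours (inj₁ i) (inj₂ j) ⊎ Neighbours (inj₂ j) (inj₁ i)

  covering? : Dec Covering
  covering? = Fin.all? λ i → Fin.all? λ j → neighbours? (inj₁ i) (inj₂ j) ⊎-dec neighbours? (inj₂ j) (inj₁ i)

  Few : ℕ → Set
  Few t = (∀ i → length (starts (inj₁ i)) ≤ t) × (∀ j → length (starts (inj₂ j)) ≤ t)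

  few? : ∀ t → Dec (Few t)
  few? t = Fin.all? (λ i → length (starts (inj₁ i)) ≤? t) ×-dec Fin.all? (λ j → length (starts (inj₂ j)) ≤? t)

  table-barRep : ∀ t {_ : True (alternating? ×-dec covering? ×-dec few? t)} → BarRep (K n) t
  table-barRep t {ok} with alternating , covering , few₁ , few₂ ← toWitness ok =
    Bars.barRep inside alt cov Sum.[ few₁ , few₂ ] (↔-id (Fin n))
    where
    alt : ∀ {r₁ r₂ c u v} → Stacked r₁ r₂ c u v → Opposite u v
    alt {u = u} {v} (stacked r₁<r₂ eq₁ eq₂ empty) with r₂<H , c<W ← inside eq₂ =
      subst₂ Opposite′ eq₁ eq₂ (alternating c<W r₂<H r₁<r₂ empty)
    restack : ∀ {u v} → Neighbours u v → ∃[ r₁ ] ∃[ r₂ ] ∃[ c ] Stacked r₁ r₂ c u v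
    restack (c , _ , r₂ , _ , r₁ , r₁<r₂ , eq₁ , eq₂ , empty) = r₁ , r₂ , c , stacked r₁<r₂ eq₁ eq₂ empty
    cov : ∀ i j → ∃[ r₁ ] ∃[ r₂ ] ∃[ c ] (Stacked r₁ r₂ c (inj₁ i) (inj₂ j) ⊎ Stacked r₁ r₂ c (inj₂ j) (inj₁ i))
    cov i j with covering i j
    ... | inj₁ N with r₁ , r₂ , c , S ← restack N = r₁ , r₂ , c , inj₁ S
    ... | inj₂ N with r₁ , r₂ , c , S ← restack N = r₁ , r₂ , c , inj₂ S

pattern x₀ = inj₁ zero
pattern x₁ = inj₁ (suc zero)
pattern x₂ = inj₁ (suc (suc zero))
pattern x₃ = inj₁ (suc (suc (suc zero)))
pattern x₄ = inj₁ (suc (suc (suc (suc zero))))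
pattern y₀ = inj₂ zero
pattern y₁ = inj₂ (suc zero)
pattern y₂ = inj₂ (suc (suc zero))
pattern y₃ = inj₂ (suc (suc (suc zero)))
pattern y₄ = inj₂ (suc (suc (suc (suc zero))))

-- Each column is read from the bottom upwards.
K₁ : BarRep (K 1) 1
K₁ = Table.table-barRep
  ( (x₀ ∷ y₀ ∷ [])
  ∷ []) 1

K₂ : BarRep (K 2) 1
K₂ = Table.table-barRep
  ( (x₀ ∷ y₀ ∷ x₁ ∷ [])
  ∷ (x₀ ∷ y₁ ∷ x₁ ∷ [])
  ∷ []) 1

K₃ : BarRep (K 3) 2
K₃ = Table.table-barRep
  ( (x₀ ∷ y₀ ∷ x₁ ∷ y₀ ∷ x₂ ∷ [])
  ∷ (x₀ ∷ y₁ ∷ x₁ ∷ y₁ ∷ x₂ ∷ [])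
  ∷ (x₀ ∷ y₂ ∷ x₁ ∷ y₂ ∷ x₂ ∷ [])
  ∷ []) 2

-- Two layouts of K₂,₄ side by side; only the Y vertices need a second bar.
K₄ : BarRep (K 4) 2
K₄ = Table.table-barRep
  ( (x₀ ∷ y₀ ∷ x₁ ∷ [])
  ∷ (x₀ ∷ y₁ ∷ x₁ ∷ [])
  ∷ (x₀ ∷ y₂ ∷ x₁ ∷ [])
  ∷ (x₀ ∷ y₃ ∷ x₁ ∷ [])
  ∷ (x₂ ∷ y₀ ∷ x₃ ∷ [])
  ∷ (x₂ ∷ y₁ ∷ x₃ ∷ [])
  ∷ (x₂ ∷ y₂ ∷ x₃ ∷ [])
  ∷ (x₂ ∷ y₃ ∷ x₃ ∷ [])
  ∷ []) 2

-- A separate table is needed because the general construction has M ≥ 3 and therefore starts at n =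
-- 6.
K₅ : BarRep (K 5) 2
K₅ = Table.table-barRep
  ( (x₀ ∷ y₀ ∷ x₂ ∷ y₂ ∷ [])
  ∷ (x₀ ∷ y₁ ∷ x₂ ∷ y₃ ∷ [])
  ∷ (x₀ ∷ y₁ ∷ x₃ ∷ y₃ ∷ [])
  ∷ (x₀ ∷ y₂ ∷ x₃ ∷ y₃ ∷ [])
  ∷ (x₁ ∷ y₂ ∷ x₄ ∷ y₃ ∷ [])
  ∷ (x₁ ∷ y₁ ∷ x₄ ∷ y₃ ∷ [])
  ∷ (x₁ ∷ y₃ ∷ x₀ ∷ y₄ ∷ [])
  ∷ (x₂ ∷ y₄ ∷ x₃ ∷ y₀ ∷ [])
  ∷ (x₂ ∷ y₄ ∷ x₁ ∷ y₀ ∷ [])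
  ∷ (x₂ ∷ y₄ ∷ x₄ ∷ y₀ ∷ [])
  ∷ []) 2

-- The block construction for n ≥ 6

data Chain {A : Set} (R : A → A → Set) : A → List A → A → Set where
  [] : ∀ {a} → Chain R a [] a
  _∷_  : ∀ {a b xs c} → R a b → Chain R b xs c → Chain R a (b ∷ xs) c

chain-++ : ∀ {A : Set} {R : A → A → Set} {a b c xs ys} → Chain R a xs b → Chain R b ys c → Chain R a (xs ++ ys) c
chain-++ []       ch = ch
chain-++ (Rab ∷ ch) ch′ = Rab ∷ chain-++ ch ch′

chain-map : ∀ {A B : Set} {R : A → A → Set} {S : B → B → Set} (f : A → B) → (∀ {a b} → R a b → S (f a) (f b)) →
  ∀ {a b xs} → Chain R a xs b → Chain S (f a) (map f xs) (f b)
chain-map f g []       = []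
chain-map f g (Rab ∷ ch) = g Rab ∷ chain-map f g ch

chain-linked : ∀ {A : Set} {R : A → A → Set} {a xs b} → Chain R a xs b → Linked R (a ∷ xs)
chain-linked []              = [-]
chain-linked (Rab ∷ [])      = Rab ∷ [-]
chain-linked (Rab ∷ ch@(_ ∷ _)) = Rab ∷ chain-linked ch

concatUpTo : ∀ {A : Set} → (ℕ → List A) → ℕ → List A
concatUpTo f zero    = []
concatUpTo f (suc n) = concatUpTo f n ++ f n

∈-concatUpTo : ∀ {A : Set} (f : ℕ → List A) {n k x} → k < n → x ∈ f k → x ∈ concatUpTo f n
∈-concatUpTo f {suc n} {k} k<n x∈ with k ≟ n
... | yes refl = ∈-++⁺ʳ (concatUpTo f n) x∈
... | no k≢n   = ∈-++⁺ˡ (∈-concatUpTo f (≤∧≢⇒< (s≤s⁻¹ k<n) k≢n) x∈)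

chain-concatUpTo : ∀ {A : Set} {R : A → A → Set} {f : ℕ → List A} (g : ℕ → A) n →
  (∀ k → k < n → Chain R (g k) (f k) (g (suc k))) → Chain R (g 0) (concatUpTo f n) (g n)
chain-concatUpTo g zero    _  = []
chain-concatUpTo g (suc n) ch = chain-++ (chain-concatUpTo g n (λ k k<n → ch k (m≤n⇒m≤1+n k<n))) (ch n ≤-refl)

-- Unlike 2 * n, this makes the ranks of consecutive slots successors definitionally.
double : ℕ → ℕ
double zero    = zero
double (suc n) = suc (suc (double n))

just-or-nothing : ∀ {A : Set} (m : Maybe A) → (∃[ x ] m ≡ just x) ⊎ m ≡ nothing
just-or-nothing (just x) = inj₁ (x , refl)
just-or-nothing nothing  = inj₂ refl

-- The columns of block i, with the indices of A, B, C, D modulo M = p + q + 3.  Rows 0 and 5 belong to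
-- the extra vertices, row 1 to A i.  Parentheses: only for the indices given in second, third, fourth.
--
--          row 2           row 3           row 4
--   v₁     C (i - 1)       B i             as in u₄ of block i - 1 (C 0 for i = 0)
--   v₂     C (i - 1) (D p) B i             C i
--   sC k   C (i - 2 - k)   B i             C i               k < p
--   sD k   D (i - 2 - k)   B i             C i               k < p
--   long   D i             B i             C i
--   swap   D i             B i (extra)     C i
--   rA k   D i             A (i - 1 - k)   C i               k < q
--   rB k   D i             B (i - 1 - k)   C i               k < q
--   u₁     D i             A (i - 1 - q)   C i
--   u₂     D i             A (i - 1 - q)   D (i - 2 - q)
--   u₃     D i             B (i - 1 - q)   D (i - 2 - q)
--   u₄     C i             B (i - 1 - q)   D (i - 2 - q) (extra)
--
-- In the last block, D i and C i persist through u₁ … u₄.  The column first lacks rows 1 and 2, so that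
-- the extra Y meets B 0; the column last lacks rows 2 and 3, so that A meets C for the last index.
data Slot : Set where
  v₁ v₂ long swap u₁ u₂ u₃ u₄ : Slot
  sC sD rA rB                 : ℕ → Slot

data Col : Set where
  first last : Col
  blk        : ℕ → Slot → Col

-- `E` is empty or a singleton and `∞?` tells which, so that one construction serves both parities
-- of n. By q ≤ p the q + 2 bars of the vertices A, B fit into t = p + 2.
module Family (p q : ℕ) (q≤p : q ≤ p) {E : Set} (_≟ᴱ_ : DecidableEquality E) (∞? : Maybe E) (∞-all : ∀ x → ∞? ≡ just x) where

  -- The differences i - j modulo M of an X-index i and a Y-index j split into 0, 1, the p values 2,
  -- ..., p + 1 and the q + 1 values -1, ..., -(q + 1), whence M = p + q + 3. The last block has
  -- index `end`.
  end M t : ℕ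
  end = 2 + (p + q)
  M   = suc end
  t   = 2 + p

  idx : ℕ → Fin M
  idx i = i mod M

  toℕ-idx : ∀ i → toℕ (idx i) ≡ i % M
  toℕ-idx i = Fin.toℕ-fromℕ< (m%n<n i M)

  toℕ-idx-< : ∀ {i} → i < M → toℕ (idx i) ≡ i
  toℕ-idx-< {i} i<M = trans (toℕ-idx i) (m<n⇒m%n≡m i<M)

  idx-cong : ∀ i j → i % M ≡ j % M → idx i ≡ idx j
  idx-cong i j eq = Fin.toℕ-injective (trans (toℕ-idx i) (trans eq (sym (toℕ-idx j))))

  idx-toℕ : ∀ j → idx (toℕ j) ≡ j
  idx-toℕ j = Fin.toℕ-injective (toℕ-idx-< (Fin.toℕ<n j))

  idx-+M : ∀ i → idx (i + M) ≡ idx i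
  idx-+M i = idx-cong (i + M) i ([m+n]%n≡m%n i M)

  -- Subtraction of m modulo M for m ≤ M, free of truncation. The inverse `fwd` finds the block in
  -- which a given short bar of vertex j lies.
  back : ℕ → ℕ → ℕ
  back i m = i + (M ∸ m)

  fwd : Fin M → ℕ → ℕ
  fwd j m = (toℕ j + m) % M

  %-+ˡ : ∀ a b → (a % M + b) % M ≡ (a + b) % M
  %-+ˡ a b = begin
    (a % M + b) % M           ≡⟨ %-distribˡ-+ (a % M) b M ⟩
    (a % M % M + b % M) % M   ≡⟨ cong (λ x → (x + b % M) % M) (m%n%n≡m%n a M) ⟩
    (a % M + b % M) % M       ≡⟨ %-distribˡ-+ a b M ⟨
    (a + b) % M               ∎
    where open ≡-Reasoning

  back-+ : ∀ i m → m ≤ M → back i m + m ≡ i + M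
  back-+ i m m≤M = trans (+-assoc i (M ∸ m) m) (cong (i +_) (m∸n+n≡m m≤M))

  fwd-back : ∀ {i} m → i < M → m ≤ M → fwd (idx (back i m)) m ≡ i
  fwd-back {i} m i<M m≤M = begin
    (toℕ (idx (back i m)) + m) % M   ≡⟨ cong (λ x → (x + m) % M) (toℕ-idx (back i m)) ⟩
    (back i m % M + m) % M           ≡⟨ %-+ˡ (back i m) m ⟩
    (back i m + m) % M               ≡⟨ cong (_% M) (back-+ i m m≤M) ⟩
    (i + M) % M                      ≡⟨ [m+n]%n≡m%n i M ⟩
    i % M                            ≡⟨ m<n⇒m%n≡m i<M ⟩
    i                                ∎
    where open ≡-Reasoning

  fwd<M : ∀ j m → fwd j m < M
  fwd<M j m = m%n<n (toℕ j + m) M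

  idx-fwd-+ : ∀ j m n → idx (fwd j m + n) ≡ idx (toℕ j + m + n)
  idx-fwd-+ j m n = idx-cong (fwd j m + n) (toℕ j + m + n) (%-+ˡ (toℕ j + m) n)

  Side : Set
  Side = (Fin M ⊎ Fin M) ⊎ E

  -- outer is A on the X side and C on the Y side, inner is B and D.
  pattern outer i = inj₁ (inj₁ i)
  pattern inner i = inj₁ (inj₂ i)
  pattern extra x = inj₂ x

  -- By the general rule row 4 of the last block would pass to D p, as end - 2 - q = p. Instead the
  -- last C stays, because its spare bar is already spent at the beginning of block 0.
  late : ℕ → Side
  late i with i ≟ end
  ... | yes _ = outer (idx i)
  ... | no _  = inner (idx (back i (2 + q)))

  turn : ℕ → Side
  turn i with i ≟ end | i ≤? p
  ... | yes _ | _     = outer (idx i)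
  ... | no _  | yes _ = Maybe.maybe (λ x → extra x) (inner (idx (back i (2 + q)))) ∞?
  ... | no _  | no _  = inner (idx (back i (2 + q)))

  second : ℕ → Slot → Side
  second i v₁     = outer (idx (back i 1))
  second i v₂ with i ≟ suc p
  ... | yes _ = inner (idx p)
  ... | no _  = outer (idx (back i 1))
  second i (sC k) = outer (idx (back i (2 + k)))
  second i (sD k) = inner (idx (back i (2 + k)))
  second i u₄ with i ≟ end
  ... | yes _ = inner (idx i)
  ... | no _  = outer (idx i)
  second i _      = inner (idx i)

  third : ℕ → Slot → Side
  third i swap with i ≟ p
  ... | yes _ = Maybe.maybe (λ x → extra x) (inner (idx i)) ∞?
  ... | no _  = inner (idx i)
  third i (rA k) = outer (idx (back i (suc k)))
  third i (rB k) = inner (idx (back i (suc k)))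
  third i u₁     = outer (idx (back i (suc q)))
  third i u₂     = outer (idx (back i (suc q)))
  third i u₃     = inner (idx (back i (suc q)))
  third i u₄     = inner (idx (back i (suc q)))
  third i _      = inner (idx i)

  opening : ℕ → Side
  opening zero    = outer (idx 0)
  opening (suc i) = turn i

  fourth : ℕ → Slot → Side
  fourth i v₁ = opening i
  fourth i u₂ = late i
  fourth i u₃ = late i
  fourth i u₄ = turn i
  fourth i _  = outer (idx i)

  content : ℕ → Col → Maybe (Side ⊎ Side)
  content 0 _         = Maybe.map (inj₂ ∘ inj₂) ∞?
  content 1 first     = nothing
  content 1 (blk i _) = just (inj₁ (outer (idx i)))
  content 1 last      = just (inj₁ (outer (idx end)))
  content 2 (blk i s) = just (inj₂ (second i s))
  content 2 _         = nothing
  content 3 first     = just (inj₁ (inner (idx 0)))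
  content 3 (blk i s) = just (inj₁ (third i s))
  content 3 last      = nothing
  content 4 first     = just (inj₂ (outer (idx 0)))
  content 4 (blk i s) = just (inj₂ (fourth i s))
  content 4 last      = just (inj₂ (outer (idx end)))
  content 5 _         = Maybe.map (inj₁ ∘ inj₂) ∞?
  content _ _         = nothing

  slotA slotB : ℕ → Slot
  slotA k with k ≟ q
  ... | yes _ = u₁
  ... | no _  = rA k
  slotB k with k ≟ q
  ... | yes _ = u₃
  ... | no _  = rB k

  -- For j ≠ end, the bar of C j at `fixC` runs from u₄ of block j into block j + 1 and supplies
  -- four pairs: with A j and B (j - 1 - q) before the border, with A (j + 1) and B (j + 1) after
  -- it. For j = end the next block is block 0, whose first slot is then the start.
  startB startC fixC : ℕ → Col
  startB zero    = first
  startB (suc i) = blk (suc i) v₁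
  startC zero    = first
  startC (suc i) = blk (suc i) v₂
  fixC i with i ≟ end
  ... | yes _ = blk 0 v₁
  ... | no _  = blk i u₄

  -- In block j + 2 + q, row 3 shows A (j + 1) and B (j + 1), the partners that D j still lacks. For
  -- j = p this is the last block, where C keeps row 4; D p is placed between A (p + 1) and B (p +
  -- 1) in row 2 instead.
  spareD : Fin M → ℕ × Col
  spareD j with toℕ j ≟ p
  ... | yes _ = 2 , blk (suc p) v₂
  ... | no _  = 4 , blk (fwd j (2 + q)) u₂

  place : Side ⊎ Side → ℕ → ℕ × Col
  place (inj₁ (outer j)) zero          = 1 , blk (toℕ j) v₁
  place (inj₁ (outer j)) (suc k)       = 3 , blk (fwd j (suc k)) (slotA k)
  place (inj₁ (inner j)) zero          = 3 , startB (toℕ j)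
  place (inj₁ (inner j)) (suc k)       = 3 , blk (fwd j (suc k)) (slotB k)
  place (inj₁ (extra x)) zero          = 5 , first
  place (inj₁ (extra x)) (suc _)       = 3 , blk p swap
  place (inj₂ (outer j)) zero          = 4 , startC (toℕ j)
  place (inj₂ (outer j)) (suc zero)    = 2 , fixC (toℕ j)
  place (inj₂ (outer j)) (suc (suc k)) = 2 , blk (fwd j (2 + k)) (sC k)
  place (inj₂ (inner j)) zero          = 2 , blk (toℕ j) long
  place (inj₂ (inner j)) (suc zero)    = spareD j
  place (inj₂ (inner j)) (suc (suc k)) = 2 , blk (fwd j (2 + k)) (sD k)
  place (inj₂ (extra x)) zero          = 0 , first
  place (inj₂ (extra x)) (suc i)       = 4 , blk i u₄

  _≟ˢ_ : DecidableEquality Side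
  _≟ˢ_ = Sum.≡-dec (Sum.≡-dec Fin._≟_ Fin._≟_) _≟ᴱ_

  open Columns _≟ˢ_ 6 t content place

  slots : List Slot
  slots = v₂ ∷ concatUpTo (λ k → sC k ∷ sD k ∷ []) p
       ++ long ∷ swap ∷ concatUpTo (λ k → rA k ∷ rB k ∷ []) q
       ++ u₁ ∷ u₂ ∷ u₃ ∷ u₄ ∷ []

  rest : List Col
  rest = concatUpTo (λ i → map (blk i) (v₁ ∷ slots)) M ++ last ∷ []

  blockNumber slotRank : Col → ℕ
  blockNumber first     = 0
  blockNumber (blk i _) = suc i
  blockNumber last      = suc M
  slotRank first            = 0
  slotRank last             = 0
  slotRank (blk _ v₁)       = 0
  slotRank (blk _ v₂)       = 1
  slotRank (blk _ (sC k))   = 2 + double k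
  slotRank (blk _ (sD k))   = 3 + double k
  slotRank (blk _ long)     = 2 + double p
  slotRank (blk _ swap)     = 3 + double p
  slotRank (blk _ (rA k))   = double k + (4 + double p)
  slotRank (blk _ (rB k))   = double k + (5 + double p)
  slotRank (blk _ u₁)       = double q + (4 + double p)
  slotRank (blk _ u₂)       = double q + (5 + double p)
  slotRank (blk _ u₃)       = double q + (6 + double p)
  slotRank (blk _ u₄)       = double q + (7 + double p)

  -- A lexicographic order that increases along the sequence; it serves to prove that no column name
  -- repeats.
  _≺_ : Col → Col → Set
  a ≺ b = blockNumber a < blockNumber b ⊎ (blockNumber a ≡ blockNumber b × slotRank a < slotRank b)

  ≺-trans : ∀ {a b c} → a ≺ b → b ≺ c → a ≺ c
  ≺-trans (inj₁ lt)        (inj₁ lt′)         = inj₁ (<-trans lt lt′)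
  ≺-trans (inj₁ lt)        (inj₂ (eq , _))    = inj₁ (<-≤-trans lt (≤-reflexive eq))
  ≺-trans (inj₂ (eq , _))  (inj₁ lt)          = inj₁ (≤-<-trans (≤-reflexive eq) lt)
  ≺-trans (inj₂ (eq , lt)) (inj₂ (eq′ , lt′)) = inj₂ (trans eq eq′ , <-trans lt lt′)

  ≺-irrefl : ∀ {a b} → a ≺ b → a ≢ b
  ≺-irrefl (inj₁ lt)       refl = n≮n _ lt
  ≺-irrefl (inj₂ (_ , lt)) refl = n≮n _ lt

  Step : Col → Col → Set
  Step a b = (∀ r → Move r a b) × a ≺ b

  step : ∀ {a b} → a ≺ b → Move 1 a b → Move 2 a b → Move 3 a b → Move 4 a b → Step a b
  step {a} {b} a≺b m₁ m₂ m₃ m₄ = moves , a≺b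
    where
    moves : ∀ r → Move r a b
    moves 0 = same refl
    moves 1 = m₁
    moves 2 = m₂
    moves 3 = m₃
    moves 4 = m₄
    moves 5 = same refl
    moves (suc (suc (suc (suc (suc (suc _)))))) = gone refl

  inner-step : ∀ {i s s′} → slotRank (blk i s′) ≡ suc (slotRank (blk i s)) →
    Move 2 (blk i s) (blk i s′) → Move 3 (blk i s) (blk i s′) → Move 4 (blk i s) (blk i s′) → Step (blk i s) (blk i s′)
  inner-step eq = step (inj₂ (refl , ≤-reflexive (sym eq))) (same refl)

  relocate : ∀ v {r i s s′} → s ≡ s′ → Placed v r (blk i s) → Placed v r (blk i s′)
  relocate v refl pl = pl

  module _ {i : ℕ} (i<M : i < M) where

    toℕ-i : toℕ (idx i) ≡ i
    toℕ-i = toℕ-idx-< i<M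

    placed-C : ∀ k → k < p → Placed (inj₂ (outer (idx (back i (2 + k))))) 2 (blk i (sC k))
    placed-C k k<p = 2 + k , +-monoʳ-< 2 k<p
      , cong (λ j → 2 , blk j (sC k)) (fwd-back (2 + k) i<M (+-mono-≤ (s≤s (s≤s (z≤n {1}))) (≤-trans (<⇒≤ k<p) (m≤m+n p q))))

    placed-D : ∀ k → k < p → Placed (inj₂ (inner (idx (back i (2 + k))))) 2 (blk i (sD k))
    placed-D k k<p = 2 + k , +-monoʳ-< 2 k<p
      , cong (λ j → 2 , blk j (sD k)) (fwd-back (2 + k) i<M (+-mono-≤ (s≤s (s≤s (z≤n {1}))) (≤-trans (<⇒≤ k<p) (m≤m+n p q))))

    k≤q⇒1+k≤M : ∀ {k} → k ≤ q → suc k ≤ M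
    k≤q⇒1+k≤M k≤q = s≤s (≤-trans k≤q (≤-trans (m≤n+m q p) (m≤n+m (p + q) 2)))

    placed-A : ∀ k → k ≤ q → Placed (inj₁ (outer (idx (back i (suc k))))) 3 (blk i (slotA k))
    placed-A k k≤q = suc k , s≤s (s≤s (≤-trans k≤q q≤p))
      , cong (λ j → 3 , blk j (slotA k)) (fwd-back (suc k) i<M (k≤q⇒1+k≤M k≤q))

    placed-B : ∀ k → k ≤ q → Placed (inj₁ (inner (idx (back i (suc k))))) 3 (blk i (slotB k))
    placed-B k k≤q = suc k , s≤s (s≤s (≤-trans k≤q q≤p))
      , cong (λ j → 3 , blk j (slotB k)) (fwd-back (suc k) i<M (k≤q⇒1+k≤M k≤q))

    slotA-< : ∀ {k} → k < q → slotA k ≡ rA k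
    slotA-< {k} k<q with k ≟ q
    ... | yes refl = contradiction k<q (n≮n _)
    ... | no _     = refl

    slotB-< : ∀ {k} → k < q → slotB k ≡ rB k
    slotB-< {k} k<q with k ≟ q
    ... | yes refl = contradiction k<q (n≮n _)
    ... | no _     = refl

    slotA-q : slotA q ≡ u₁
    slotA-q with q ≟ q
    ... | yes _  = refl
    ... | no q≢q = contradiction refl q≢q

    slotB-q : slotB q ≡ u₃
    slotB-q with q ≟ q
    ... | yes _  = refl
    ... | no q≢q = contradiction refl q≢q

    placed-rA : ∀ k → k < q → Placed (inj₁ (outer (idx (back i (suc k))))) 3 (blk i (rA k))
    placed-rA k k<q = relocate (inj₁ (outer (idx (back i (suc k))))) (slotA-< k<q) (placed-A k (<⇒≤ k<q))

    placed-rB : ∀ k → k < q → Placed (inj₁ (inner (idx (back i (suc k))))) 3 (blk i (rB k))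
    placed-rB k k<q = relocate (inj₁ (inner (idx (back i (suc k))))) (slotB-< k<q) (placed-B k (<⇒≤ k<q))

    placed-u₁ : Placed (inj₁ (outer (idx (back i (suc q))))) 3 (blk i u₁)
    placed-u₁ = relocate (inj₁ (outer (idx (back i (suc q))))) slotA-q (placed-A q ≤-refl)

    placed-u₃ : Placed (inj₁ (inner (idx (back i (suc q))))) 3 (blk i u₃)
    placed-u₃ = relocate (inj₁ (inner (idx (back i (suc q))))) slotB-q (placed-B q ≤-refl)

    v₁-v₂ : Step (blk i v₁) (blk i v₂)
    v₁-v₂ = inner-step refl move₂ (same refl) (move₄ i i<M)
      where
      move₂ : Move 2 (blk i v₁) (blk i v₂)
      move₂ with i ≟ suc p in eq
      ... | no _     = same (cong (λ s → just (inj₂ s)) fixed)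
        where
        fixed : second i v₂ ≡ second i v₁
        fixed rewrite eq = refl
      ... | yes refl = new (inj₂ (inner (idx p))) (cong (λ s → just (inj₂ s)) fixed) (1 , s≤s (s≤s z≤n) , spare)
        where
        fixed : second (suc p) v₂ ≡ inner (idx p)
        fixed rewrite eq = refl
        spare : spareD (idx p) ≡ (2 , blk (suc p) v₂)
        spare with toℕ (idx p) ≟ p
        ... | yes _ = refl
        ... | no ne = contradiction (toℕ-idx-< (s≤s (≤-trans (m≤m+n p q) (m≤n+m (p + q) 2)))) ne
      move₄ : ∀ i → i < M → Move 4 (blk i v₁) (blk i v₂)
      move₄ zero    _ = same refl
      move₄ (suc i) i<M = new (inj₂ (outer (idx (suc i)))) refl
        (0 , s≤s z≤n , cong (λ j → 4 , startC j) (toℕ-idx-< i<M))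

    beforeS : ℕ → Slot
    beforeS zero    = v₂
    beforeS (suc k) = sD k

    beforeR : ℕ → Slot
    beforeR zero    = swap
    beforeR (suc k) = rB k

    S-C : ∀ k → k < p → Step (blk i (beforeS k)) (blk i (sC k))
    S-C zero    k<p = inner-step refl (new _ refl (placed-C 0 k<p)) (same refl) (same refl)
    S-C (suc k) k<p = inner-step refl (new _ refl (placed-C (suc k) k<p)) (same refl) (same refl)

    S-D : ∀ k → k < p → Step (blk i (sC k)) (blk i (sD k))
    S-D k k<p = inner-step refl (new _ refl (placed-D k k<p)) (same refl) (same refl)

    placed-long : Placed (inj₂ (inner (idx i))) 2 (blk i long)
    placed-long = 0 , s≤s z≤n , cong (λ j → 2 , blk j long) toℕ-i

    S-long : ∀ k → k ≡ p → Step (blk i (beforeS k)) (blk i long)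
    S-long zero    refl = inner-step refl (new _ refl placed-long) (same refl) (same refl)
    S-long (suc k) refl = inner-step refl (new _ refl placed-long) (same refl) (same refl)

    long-swap : Step (blk i long) (blk i swap)
    long-swap = inner-step refl (same refl) move₃ (same refl)
      where
      move₃ : Move 3 (blk i long) (blk i swap)
      move₃ with i ≟ p in eq | just-or-nothing ∞?
      ... | no _     | _       = same (cong (λ s → just (inj₁ s)) unswapped)
        where
        unswapped : third i swap ≡ inner (idx i)
        unswapped rewrite eq = refl
      ... | yes refl | inj₂ eq∞ = same (cong (λ s → just (inj₁ s)) unswapped)
        where
        unswapped : third p swap ≡ inner (idx p)
        unswapped rewrite eq | eq∞ = refl
      ... | yes refl | inj₁ (x , eq∞) = new (inj₁ (extra x)) (cong (λ s → just (inj₁ s)) swapped) (1 , s≤s (s≤s z≤n) , refl)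
        where
        swapped : third p swap ≡ extra x
        swapped rewrite eq | eq∞ = refl

    R-A : ∀ k → k < q → Step (blk i (beforeR k)) (blk i (rA k))
    R-A zero    k<q = inner-step refl (same refl)
      (new _ refl (placed-rA 0 k<q)) (same refl)
    R-A (suc k) k<q = inner-step (cong suc (sym (+-suc (double k) _))) (same refl)
      (new _ refl (placed-rA (suc k) k<q)) (same refl)

    R-B : ∀ k → k < q → Step (blk i (rA k)) (blk i (rB k))
    R-B k k<q = inner-step (+-suc (double k) _) (same refl)
      (new _ refl (placed-rB k k<q)) (same refl)

    R-u₁ : ∀ k → k ≡ q → Step (blk i (beforeR k)) (blk i u₁)
    R-u₁ zero    refl = inner-step refl (same refl) (new _ refl placed-u₁) (same refl)
    R-u₁ (suc k) refl = inner-step (cong suc (sym (+-suc (double k) _))) (same refl)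
      (new _ refl placed-u₁) (same refl)

    spare-u₂ : i ≢ end → Placed (inj₂ (inner (idx (back i (2 + q))))) 4 (blk i u₂)
    spare-u₂ i≢end = 1 , s≤s (s≤s z≤n) , placed
      where
      fb : fwd (idx (back i (2 + q))) (2 + q) ≡ i
      fb = fwd-back (2 + q) i<M (s≤s (s≤s (m≤n⇒m≤1+n (m≤n+m q p))))
      placed : spareD (idx (back i (2 + q))) ≡ (4 , blk i u₂)
      placed with toℕ (idx (back i (2 + q))) ≟ p
      ... | no _   = cong (λ j → 4 , blk j u₂) fb
      -- Index p is possible only in block p + 2 + q = end, which is excluded here.
      ... | yes eq = contradiction (trans (sym fb) (trans (cong (λ x → (x + (2 + q)) % M) eq)
              (trans (cong (_% M) (trans (+-suc p (suc q)) (cong suc (+-suc p q)))) (m<n⇒m%n≡m ≤-refl)))) i≢end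

    u₁-u₂ : Step (blk i u₁) (blk i u₂)
    u₁-u₂ = inner-step (+-suc (double q) _) (same refl) (same refl) move₄
      where
      move₄ : Move 4 (blk i u₁) (blk i u₂)
      move₄ with i ≟ end in eq
      ... | yes _    = same (cong (λ s → just (inj₂ s)) is)
        where
        is : late i ≡ outer (idx i)
        is rewrite eq = refl
      ... | no i≢end = new _ (cong (λ s → just (inj₂ s)) is) (spare-u₂ i≢end)
        where
        is : late i ≡ inner (idx (back i (2 + q)))
        is rewrite eq = refl

    u₂-u₃ : Step (blk i u₂) (blk i u₃)
    u₂-u₃ = inner-step (+-suc (double q) _) (same refl)
      (new _ refl placed-u₃) (same refl)

    u₃-u₄ : Step (blk i u₃) (blk i u₄)
    u₃-u₄ = inner-step (+-suc (double q) _) move₂ (same refl) move₄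
      where
      move₂ : Move 2 (blk i u₃) (blk i u₄)
      move₂ with i ≟ end in eq
      ... | yes _    = same (cong (λ s → just (inj₂ s)) is)
        where
        is : second i u₄ ≡ inner (idx i)
        is rewrite eq = refl
      ... | no i≢end = new (inj₂ (outer (idx i))) (cong (λ s → just (inj₂ s)) is) (1 , s≤s (s≤s z≤n) , cong (2 ,_) fix)
        where
        is : second i u₄ ≡ outer (idx i)
        is rewrite eq = refl
        fix : fixC (toℕ (idx i)) ≡ blk i u₄
        fix rewrite toℕ-i | eq = refl
      move₄ : Move 4 (blk i u₃) (blk i u₄)
      move₄ with i ≟ end in eq | i ≤? p in eqᵖ | just-or-nothing ∞?
      ... | yes _    | _       | _       = same (cong (λ s → just (inj₂ s)) is)
        where
        is : turn i ≡ late i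
        is rewrite eq = refl
      ... | no _     | yes i≤p | inj₁ (x , eq∞) = new (inj₂ (extra x)) (cong (λ s → just (inj₂ s)) is) (suc i , s≤s (s≤s i≤p) , refl)
        where
        is : turn i ≡ extra x
        is rewrite eq | eqᵖ | eq∞ = refl
      ... | no _     | yes _   | inj₂ eq∞ = same (cong (λ s → just (inj₂ s)) is)
        where
        is : turn i ≡ late i
        is rewrite eq | eqᵖ | eq∞ = refl
      ... | no _     | no _    | _       = same (cong (λ s → just (inj₂ s)) is)
        where
        is : turn i ≡ late i
        is rewrite eq | eqᵖ = refl

    block-chain : Chain Step (blk i v₁) (map (blk i) slots) (blk i u₄)
    block-chain = chain-map {R = λ s s′ → Step (blk i s) (blk i s′)} (blk i) (λ x → x)
      (v₁-v₂ ∷ chain-++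
        (chain-concatUpTo beforeS p (λ k k<p → S-C k k<p ∷ S-D k k<p ∷ []))
        (S-long p refl ∷ long-swap ∷ chain-++
          (chain-concatUpTo beforeR q (λ k k<q → R-A k k<q ∷ R-B k k<q ∷ []))
          (R-u₁ q refl ∷ u₁-u₂ ∷ u₂-u₃ ∷ u₃-u₄ ∷ [])))

  transition : ∀ {i} → suc i < M → Step (blk i u₄) (blk (suc i) v₁)
  transition {i} i′<M = step (inj₁ ≤-refl)
    (new _ refl (0 , s≤s z≤n , cong (λ j → 1 , blk j v₁) (toℕ-idx-< i′<M)))
    (same (cong (λ s → just (inj₂ s)) move₂))
    (new _ refl (0 , s≤s z≤n , cong (λ j → 3 , startB j) (toℕ-idx-< i′<M)))
    (same refl)
    where
    -- The bar of C i begun in u₄ is the C ((i + 1) - 1) of the next block, so crossing the border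
    -- costs no new bar in row 2.
    move₂ : outer (idx (back (suc i) 1)) ≡ second i u₄
    move₂ with i ≟ end
    ... | yes refl = contradiction i′<M (n≮n _)
    ... | no _     = cong (λ j → outer j) (trans (cong idx (sym (+-suc i end))) (idx-+M i))

  opening-step : Step first (blk 0 v₁)
  opening-step = step {first} {blk 0 v₁} (inj₁ ≤-refl)
    (new (inj₁ (outer (idx 0))) refl (0 , s≤s z≤n , refl))
    (new (inj₂ (outer (idx (back 0 1)))) refl (1 , s≤s (s≤s z≤n) , cong (2 ,_) fix))
    (same refl)
    (same refl)
    where
    fix : fixC (toℕ (idx (back 0 1))) ≡ blk 0 v₁
    fix rewrite toℕ-idx-< {end} ≤-refl with end ≟ end
    ... | yes _ = refl
    ... | no ne = contradiction refl ne

  closing-step : Step (blk end u₄) last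
  closing-step = step (inj₁ ≤-refl) (same refl) (gone refl) (gone refl) (same (cong (λ s → just (inj₂ s)) (sym is)))
    where
    is : turn end ≡ outer (idx end)
    is with end ≟ end
    ... | yes _ = refl
    ... | no ne = contradiction refl ne

  chain : Chain Step first rest last
  chain = chain-++ (chain-concatUpTo preceding M blocks) (closing-step ∷ [])
    where
    preceding : ℕ → Col
    preceding zero    = first
    preceding (suc i) = blk i u₄
    enter : ∀ i → i < M → Step (preceding i) (blk i v₁)
    enter zero    _   = opening-step
    enter (suc i) i<M = transition i<M
    blocks : ∀ i → i < M → Chain Step (preceding i) (map (blk i) (v₁ ∷ slots)) (blk i u₄)
    blocks i i<M = enter i i<M ∷ block-chain i<M

  linked : Linked Step (first ∷ rest)
  linked = chain-linked chain

  distinct : Unique (first ∷ rest)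
  distinct = AllPairs.map ≺-irrefl (Linked⇒AllPairs (λ {a} {b} {c} → ≺-trans {a} {b} {c}) (Linked.map proj₂ linked))

  high : ∀ {r c v} → content r c ≡ just v → r < 6
  high {0} _ = s≤s z≤n
  high {1} _ = s≤s (s≤s z≤n)
  high {2} _ = s≤s (s≤s (s≤s z≤n))
  high {3} _ = s≤s (s≤s (s≤s (s≤s z≤n)))
  high {4} _ = s≤s (s≤s (s≤s (s≤s (s≤s z≤n))))
  high {5} _ = s≤s (s≤s (s≤s (s≤s (s≤s (s≤s z≤n)))))
  high {suc (suc (suc (suc (suc (suc _)))))} ()

  maybe-map-just : ∀ {A B : Set} {f : A → B} (m : Maybe A) {y} → Maybe.map f m ≡ just y → ∃[ x ] f x ≡ y
  maybe-map-just (just x) refl = x , refl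

  initial : ∀ {r v} → content r first ≡ just v → Placed v r first
  initial {0} eq with x , refl ← maybe-map-just ∞? eq = 0 , s≤s z≤n , refl
  initial {3} refl = 0 , s≤s z≤n , refl
  initial {4} refl = 0 , s≤s z≤n , refl
  initial {5} eq with x , refl ← maybe-map-just ∞? eq = 0 , s≤s z≤n , refl
  initial {1} ()
  initial {2} ()
  initial {suc (suc (suc (suc (suc (suc _)))))} ()

  Coloured : ℕ → Side ⊎ Side → Set
  Coloured zero          (inj₁ _) = ⊥
  Coloured zero          (inj₂ _) = ⊤
  Coloured (suc zero)    (inj₁ _) = ⊤
  Coloured (suc zero)    (inj₂ _) = ⊥
  Coloured (suc (suc r)) v        = Coloured r v

  coloured : ∀ r c {v} → content r c ≡ just v → Coloured r v
  coloured 0 _ eq with _ , refl ← maybe-map-just ∞? eq = tt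
  coloured 1 (blk _ _) refl = tt
  coloured 1 last      refl = tt
  coloured 2 (blk _ _) refl = tt
  coloured 3 first     refl = tt
  coloured 3 (blk _ _) refl = tt
  coloured 4 first     refl = tt
  coloured 4 (blk _ _) refl = tt
  coloured 4 last      refl = tt
  coloured 5 _ eq with _ , refl ← maybe-map-just ∞? eq = tt
  coloured (suc (suc (suc (suc (suc (suc _)))))) _ ()

  opposite₀₁ : ∀ u v → Coloured 0 u → Coloured 1 v → Opposite u v
  opposite₀₁ (inj₂ _) (inj₁ _) _ _ = tt

  opposite₁₀ : ∀ u v → Coloured 1 u → Coloured 0 v → Opposite u v
  opposite₁₀ (inj₁ _) (inj₂ _) _ _ = tt

  -- Even rows carry Y and odd rows X. The gaps inside `first` and `last` comprise two rows each, so
  -- neighbours across a gap still have opposite parity; two rows of equal parity always have a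
  -- filled row between them.
  alternating : ∀ {r₁ r₂ c u v} → Tower r₁ r₂ c u v → Opposite u v
  alternating {r₁} {r₂} {c} {u} {v} (tower r₁<r₂ lower upper empty) =
    go r₁ r₂ c r₁<r₂ lower upper (coloured r₁ c lower) (coloured r₂ c upper) (λ r → empty {r})
    where
    go : ∀ r₁ r₂ c → r₁ < r₂ → content r₁ c ≡ just u → content r₂ c ≡ just v → Coloured r₁ u → Coloured r₂ v →
      (∀ r → r < r₂ → r₁ < r → content r c ≡ nothing) → Opposite u v
    go 0 1 _ _ _ _ κ κ′ _ = opposite₀₁ u v κ κ′
    go 0 3 _ _ _ _ κ κ′ _ = opposite₀₁ u v κ κ′
    go 0 5 _ _ _ _ κ κ′ _ = opposite₀₁ u v κ κ′
    go 1 2 _ _ _ _ κ κ′ _ = opposite₁₀ u v κ κ′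
    go 1 4 _ _ _ _ κ κ′ _ = opposite₁₀ u v κ κ′
    go 2 3 _ _ _ _ κ κ′ _ = opposite₀₁ u v κ κ′
    go 2 5 _ _ _ _ κ κ′ _ = opposite₀₁ u v κ κ′
    go 3 4 _ _ _ _ κ κ′ _ = opposite₁₀ u v κ κ′
    go 4 5 _ _ _ _ κ κ′ _ = opposite₀₁ u v κ κ′
    go 0 2 (blk _ _) _ _ _ _ _ e with () ← e 1 ≤-refl (s≤s z≤n)
    go 0 4 first     _ _ _ _ _ e with () ← e 3 ≤-refl (s≤s z≤n)
    go 0 4 (blk _ _) _ _ _ _ _ e with () ← e 3 ≤-refl (s≤s z≤n)
    go 0 4 last      _ _ _ _ _ e with () ← e 1 (s≤s (s≤s z≤n)) (s≤s z≤n)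
    go 1 3 (blk _ _) _ _ _ _ _ e with () ← e 2 ≤-refl ≤-refl
    go 1 5 (blk _ _) _ _ _ _ _ e with () ← e 4 ≤-refl (s≤s (s≤s z≤n))
    go 1 5 last      _ _ _ _ _ e with () ← e 4 ≤-refl (s≤s (s≤s z≤n))
    go 2 4 (blk _ _) _ _ _ _ _ e with () ← e 3 ≤-refl ≤-refl
    go 3 5 first     _ _ _ _ _ e with () ← e 4 ≤-refl ≤-refl
    go 3 5 (blk _ _) _ _ _ _ _ e with () ← e 4 ≤-refl ≤-refl
    go 0 2 first _ _ () _ _ _
    go 0 2 last  _ _ () _ _ _
    go 1 3 first _ () _ _ _ _
    go 1 3 last  _ _ () _ _ _
    go 1 5 first _ () _ _ _ _
    go 2 4 first _ () _ _ _ _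
    go 2 4 last  _ () _ _ _ _
    go 3 5 last  _ () _ _ _ _
    go _ (suc (suc (suc (suc (suc (suc _)))))) _ _ _ () _ _ _
    go (suc (suc (suc (suc (suc (suc _)))))) _ _ _ () _ _ _ _
    go (suc _) 1 _ (s≤s ()) _ _ _ _ _
    go (suc (suc _)) 2 _ (s≤s (s≤s ())) _ _ _ _ _
    go (suc (suc (suc _))) 3 _ (s≤s (s≤s (s≤s ()))) _ _ _ _ _
    go (suc (suc (suc (suc _)))) 4 _ (s≤s (s≤s (s≤s (s≤s ())))) _ _ _ _ _
    go (suc (suc (suc (suc (suc _))))) 5 _ (s≤s (s≤s (s≤s (s≤s (s≤s ()))))) _ _ _ _ _
    go _ 0 _ () _ _ _ _ _

  -- Every X-Y pair meets

  data Related (i j : Fin M) : Set where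
    equal    : i ≡ j → Related i j
    adjacent : idx (suc (toℕ j)) ≡ i → Related i j
    inS      : ∀ k → k < p → idx (back (toℕ i) (2 + k)) ≡ j → Related i j
    inR      : ∀ k → k ≤ q → idx (back (toℕ j) (suc k)) ≡ i → Related i j

  -- Differences outside the direct ranges wrap round modulo M: 2 + k is -(1 + (p + q - k)), -(1 +
  -- k) is 2 + (p + q - k), and -(p + q + 2) is 1.
  related : ∀ i j → Related i j
  related i j with <-cmp (toℕ i) (toℕ j)
  ... | tri≈ _ eq _ = equal (Fin.toℕ-injective eq)
  ... | tri> _ _ j<i = descend (toℕ i ∸ suc (toℕ j)) (m+[n∸m]≡n j<i)
    where
    descend : ∀ m → suc (toℕ j) + m ≡ toℕ i → Related i j
    descend zero    eq = adjacent (trans (cong idx (trans (sym (+-identityʳ _)) eq)) (idx-toℕ i))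
    descend (suc k) eq with k <? p
    ... | yes k<p = inS k k<p (trans (cong idx (begin
        toℕ i + (M ∸ (2 + k))                    ≡⟨ cong (_+ (M ∸ (2 + k))) eq ⟨
        suc (toℕ j) + suc k + (M ∸ (2 + k))      ≡⟨ cong (_+ (M ∸ (2 + k))) (sym (+-suc (toℕ j) (suc k))) ⟩
        toℕ j + (2 + k) + (M ∸ (2 + k))          ≡⟨ +-assoc (toℕ j) (2 + k) _ ⟩
        toℕ j + ((2 + k) + (M ∸ (2 + k)))        ≡⟨ cong (toℕ j +_) (m+[n∸m]≡n 2+k≤M) ⟩
        toℕ j + M                                ∎))
        (trans (idx-+M (toℕ j)) (idx-toℕ j)))
      where
      open ≡-Reasoning
      2+k≤M : 2 + k ≤ M
      2+k≤M = s≤s (s≤s (≤-trans (<⇒≤ k<p) (m≤n⇒m≤1+n (m≤m+n p q))))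
    ... | no k≮p = inR (p + q ∸ k) k′≤q (trans (cong idx (begin
        toℕ j + (M ∸ suc (p + q ∸ k))            ≡⟨ cong (toℕ j +_) (sub (p + q ∸ k) (m+[n∸m]≡n k≤p+q)) ⟩
        toℕ j + (2 + k)                          ≡⟨ +-suc (toℕ j) (suc k) ⟩
        suc (toℕ j) + suc k                      ≡⟨ eq ⟩
        toℕ i                                    ∎)) (idx-toℕ i))
      where
      open ≡-Reasoning
      k′≤q : p + q ∸ k ≤ q
      k′≤q = ≤-trans (∸-monoʳ-≤ (p + q) (≮⇒≥ k≮p)) (≤-reflexive (m+n∸m≡n p q))
      k≤p+q : k ≤ p + q
      k≤p+q = s≤s⁻¹ (s≤s⁻¹ (s≤s⁻¹ (≤-trans (s≤s (≤-trans (m≤n+m (2 + k) (toℕ j)) (≤-reflexive (trans (+-suc (toℕ j) (suc k)) eq)))) (Fin.toℕ<n i))))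
      sub : ∀ k′ → k + k′ ≡ p + q → M ∸ suc k′ ≡ 2 + k
      sub k′ e = trans (cong (λ n → 2 + n ∸ k′) (sym e)) (m+n∸n≡m (2 + k) k′)
  ... | tri< i<j _ _ = ascend (toℕ j ∸ suc (toℕ i)) (m+[n∸m]≡n i<j)
    where
    ascend : ∀ k → suc (toℕ i) + k ≡ toℕ j → Related i j
    ascend k eq with k ≤? q
    ... | yes k≤q = inR k k≤q (trans (cong idx (begin
        toℕ j + (M ∸ suc k)                      ≡⟨ cong (_+ (M ∸ suc k)) eq ⟨
        suc (toℕ i) + k + (M ∸ suc k)            ≡⟨ cong (_+ (M ∸ suc k)) (sym (+-suc (toℕ i) k)) ⟩
        toℕ i + suc k + (M ∸ suc k)              ≡⟨ +-assoc (toℕ i) (suc k) _ ⟩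
        toℕ i + (suc k + (M ∸ suc k))            ≡⟨ cong (toℕ i +_) (m+[n∸m]≡n (s≤s (≤-trans k≤q (≤-trans (m≤n+m q p) (m≤n+m (p + q) 2))))) ⟩
        toℕ i + M                                ∎))
        (trans (idx-+M (toℕ i)) (idx-toℕ i)))
      where open ≡-Reasoning
    ... | no k≰q with k ≟ suc (p + q)
    ...   | yes refl = adjacent (trans (cong idx (trans (cong suc (sym eq)) (cong suc (sym (+-suc (toℕ i) (suc (p + q)))))))
              (trans (cong idx (sym (+-suc (toℕ i) (2 + (p + q))))) (trans (idx-+M (toℕ i)) (idx-toℕ i))))
    ...   | no k≢ = inS (p + q ∸ k) k′<p (trans (cong idx (begin
        toℕ i + (M ∸ (2 + (p + q ∸ k)))          ≡⟨ cong (toℕ i +_) (sub (p + q ∸ k) (m+[n∸m]≡n k≤p+q)) ⟩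
        toℕ i + suc k                            ≡⟨ +-suc (toℕ i) k ⟩
        suc (toℕ i) + k                          ≡⟨ eq ⟩
        toℕ j                                    ∎)) (idx-toℕ j))
      where
      open ≡-Reasoning
      k≤p+q : k ≤ p + q
      k≤p+q = s≤s⁻¹ (≤∧≢⇒< (s≤s⁻¹ (s≤s⁻¹ (≤-trans (s≤s (≤-trans (s≤s (m≤n+m k (toℕ i))) (≤-reflexive eq))) (Fin.toℕ<n j)))) k≢)
      k′<p : p + q ∸ k < p
      k′<p = ≤-trans (s≤s (∸-monoʳ-≤ (p + q) (≰⇒> k≰q))) (≤-reflexive (trans (sym (+-∸-assoc 1 {p + q} {suc q} (≤-trans (≰⇒> k≰q) k≤p+q))) (m+n∸n≡m p q)))
      sub : ∀ k′ → k + k′ ≡ p + q → M ∸ (2 + k′) ≡ suc k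
      sub k′ e = trans (cong (λ n → suc n ∸ k′) (sym e)) (m+n∸n≡m (suc k) k′)

  Covered : Side → Side → Set
  Covered u v = ∃[ r₁ ] ∃[ r₂ ] ∃[ c ] c ∈ first ∷ rest × (Tower r₁ r₂ c (inj₁ u) (inj₂ v) ⊎ Tower r₁ r₂ c (inj₂ v) (inj₁ u))

  adjacent-tower : ∀ {r c u v} → content r c ≡ just u → content (suc r) c ≡ just v → Tower r (suc r) c u v
  adjacent-tower lower upper = tower ≤-refl lower upper (λ r<1+r₁ r₁<r → contradiction (s≤s⁻¹ r<1+r₁) (<⇒≱ r₁<r))

  x-below : ∀ {u v} r c → c ∈ first ∷ rest → content r c ≡ just (inj₁ u) → content (suc r) c ≡ just (inj₂ v) → Covered u v
  x-below r c c∈ lower upper = r , suc r , c , c∈ , inj₁ (adjacent-tower lower upper)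

  y-below : ∀ {u v} r c → c ∈ first ∷ rest → content r c ≡ just (inj₂ v) → content (suc r) c ≡ just (inj₁ u) → Covered u v
  y-below r c c∈ lower upper = r , suc r , c , c∈ , inj₂ (adjacent-tower lower upper)

  blk-∈ : ∀ {i s} → i < M → s ∈ v₁ ∷ slots → blk i s ∈ first ∷ rest
  blk-∈ {i} i<M s∈ = there (∈-++⁺ˡ (∈-concatUpTo (λ i → map (blk i) (v₁ ∷ slots)) i<M (∈-map⁺ (blk i) s∈)))

  last-∈ : last ∈ first ∷ rest
  last-∈ = there (∈-++⁺ʳ (concatUpTo (λ i → map (blk i) (v₁ ∷ slots)) M) (here refl))

  private
    Sslots Rslots : ℕ → List Slot
    Sslots k = sC k ∷ sD k ∷ []
    Rslots k = rA k ∷ rB k ∷ []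

  after-S : ∀ {s} → s ∈ long ∷ swap ∷ concatUpTo Rslots q ++ u₁ ∷ u₂ ∷ u₃ ∷ u₄ ∷ [] → s ∈ v₁ ∷ slots
  after-S s∈ = there (there (∈-++⁺ʳ (concatUpTo Sslots p) s∈))

  after-R : ∀ {s} → s ∈ u₁ ∷ u₂ ∷ u₃ ∷ u₄ ∷ [] → s ∈ v₁ ∷ slots
  after-R s∈ = after-S (there (there (∈-++⁺ʳ (concatUpTo Rslots q) s∈)))

  v₁-∈ : v₁ ∈ v₁ ∷ slots
  v₁-∈ = here refl
  v₂-∈ : v₂ ∈ v₁ ∷ slots
  v₂-∈ = there (here refl)
  sC-∈ : ∀ {k} → k < p → sC k ∈ v₁ ∷ slots
  sC-∈ k<p = there (there (∈-++⁺ˡ (∈-concatUpTo Sslots k<p (here refl))))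
  sD-∈ : ∀ {k} → k < p → sD k ∈ v₁ ∷ slots
  sD-∈ k<p = there (there (∈-++⁺ˡ (∈-concatUpTo Sslots k<p (there (here refl)))))
  long-∈ : long ∈ v₁ ∷ slots
  long-∈ = after-S (here refl)
  swap-∈ : swap ∈ v₁ ∷ slots
  swap-∈ = after-S (there (here refl))
  rA-∈ : ∀ {k} → k < q → rA k ∈ v₁ ∷ slots
  rA-∈ k<q = after-S (there (there (∈-++⁺ˡ (∈-concatUpTo Rslots k<q (here refl)))))
  rB-∈ : ∀ {k} → k < q → rB k ∈ v₁ ∷ slots
  rB-∈ k<q = after-S (there (there (∈-++⁺ˡ (∈-concatUpTo Rslots k<q (there (here refl))))))
  u₁-∈ : u₁ ∈ v₁ ∷ slots
  u₁-∈ = after-R (here refl)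
  u₂-∈ : u₂ ∈ v₁ ∷ slots
  u₂-∈ = after-R (there (here refl))
  u₃-∈ : u₃ ∈ v₁ ∷ slots
  u₃-∈ = after-R (there (there (here refl)))
  u₄-∈ : u₄ ∈ v₁ ∷ slots
  u₄-∈ = after-R (there (there (there (here refl))))

  outer-idx : ∀ j → _≡_ {A = Side} (outer (idx (toℕ j))) (outer j)
  outer-idx j = cong (λ j → outer j) (idx-toℕ j)

  inner-idx : ∀ j → _≡_ {A = Side} (inner (idx (toℕ j))) (inner j)
  inner-idx j = cong (λ j → inner j) (idx-toℕ j)

  second-u₄ : ∀ {i} → i ≢ end → second i u₄ ≡ outer (idx i)
  second-u₄ {i} i≢end with i ≟ end
  ... | yes eq = contradiction eq i≢end
  ... | no _   = refl

  second-v₂ : second (suc p) v₂ ≡ inner (idx p)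
  second-v₂ with suc p ≟ suc p
  ... | yes _ = refl
  ... | no ne = contradiction refl ne

  late-end : late end ≡ outer (idx end)
  late-end with end ≟ end
  ... | yes _ = refl
  ... | no ne = contradiction refl ne

  late-≢end : ∀ {i} → i ≢ end → late i ≡ inner (idx (back i (2 + q)))
  late-≢end {i} i≢end with i ≟ end
  ... | yes eq = contradiction eq i≢end
  ... | no _   = refl

  p<end : p < end
  p<end = s≤s (≤-trans (m≤m+n p q) (n≤1+n (p + q)))

  turn-extra : ∀ {i} x → i ≤ p → turn i ≡ extra x
  turn-extra {i} x i≤p with i ≟ end | i ≤? p
  ... | yes refl | _      = contradiction i≤p (<⇒≱ p<end)
  ... | no _     | no i≰p = contradiction i≤p i≰p
  ... | no _     | yes _  rewrite ∞-all x = refl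

  swap-extra : ∀ x → third p swap ≡ extra x
  swap-extra x with p ≟ p
  ... | no ne = contradiction refl ne
  ... | yes _ rewrite ∞-all x = refl

  -- The block whose slots u₂ and u₃ carry the spare bar of D j.
  spareBlock : Fin M → ℕ
  spareBlock j = fwd j (2 + q)

  module _ (j : Fin M) where
    back-spare : idx (back (spareBlock j) (2 + q)) ≡ j
    back-spare = trans (idx-fwd-+ j (2 + q) (M ∸ (2 + q))) (trans (cong idx (trans (+-assoc (toℕ j) (2 + q) _)
      (cong (toℕ j +_) (m+[n∸m]≡n (s≤s (s≤s (m≤n⇒m≤1+n (m≤n+m q p)))))))) (trans (idx-+M (toℕ j)) (idx-toℕ j)))

    -- Row 3 of this block carries the index j + 1, first as A and then as B, so one bar of D j in
    -- row 4 serves both pairs of difference 1.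
    back-spare′ : idx (back (spareBlock j) (suc q)) ≡ idx (suc (toℕ j))
    back-spare′ = trans (idx-fwd-+ j (2 + q) (M ∸ suc q)) (trans (cong idx (trans
      (trans (+-assoc (toℕ j) (2 + q) _) (trans (cong (toℕ j +_) (cong suc (m+[n∸m]≡n (s≤s (≤-trans (m≤n+m q p) (m≤n+m (p + q) 2)))))) (+-suc (toℕ j) M)))
      refl)) (idx-+M (suc (toℕ j))))

    spareBlock≢end : toℕ j ≢ p → spareBlock j ≢ end
    spareBlock≢end j≢p eq = j≢p (begin
      toℕ j                                      ≡⟨ cong toℕ back-spare ⟨
      toℕ (idx (back (spareBlock j) (2 + q)))    ≡⟨ cong (λ i → toℕ (idx (back i (2 + q)))) eq ⟩
      toℕ (idx (end + (M ∸ (2 + q))))            ≡⟨ cong (λ m → toℕ (idx (end + m))) (trans (cong (_∸ q) (sym (+-suc 0 (p + q)))) (m+n∸n≡m (suc p) q)) ⟩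
      toℕ (idx (end + suc p))                    ≡⟨ cong (λ m → toℕ (idx m)) (trans (+-suc end p) (+-comm M p)) ⟩
      toℕ (idx (p + M))                          ≡⟨ cong toℕ (idx-+M p) ⟩
      toℕ (idx p)                                ≡⟨ toℕ-idx-< (m≤n⇒m≤1+n p<end) ⟩
      p                                          ∎)
      where open ≡-Reasoning

    late-spare : toℕ j ≢ p → late (spareBlock j) ≡ inner j
    late-spare j≢p = trans (late-≢end (spareBlock≢end j≢p)) (cong (λ j → inner j) back-spare)

  X≡ : ∀ {u v : Side} → u ≡ v → _≡_ {A = Maybe (Side ⊎ Side)} (just (inj₁ u)) (just (inj₁ v))
  X≡ = cong (λ u → just (inj₁ u))

  Y≡ : ∀ {u v : Side} → u ≡ v → _≡_ {A = Maybe (Side ⊎ Side)} (just (inj₂ u)) (just (inj₂ v))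
  Y≡ = cong (λ u → just (inj₂ u))

  outer≡ : ∀ {i j} → i ≡ j → _≡_ {A = Side} (outer i) (outer j)
  outer≡ = cong (λ j → outer j)

  inner≡ : ∀ {i j} → i ≡ j → _≡_ {A = Side} (inner i) (inner j)
  inner≡ = cong (λ j → inner j)

  content₀ : ∀ x c → content 0 c ≡ just (inj₂ (extra x))
  content₀ x _ rewrite ∞-all x = refl

  content₅ : ∀ x c → content 5 c ≡ just (inj₁ (extra x))
  content₅ x _ rewrite ∞-all x = refl

  previous : ∀ {i} j → idx (suc (toℕ j)) ≡ i → idx (back (toℕ i) 1) ≡ j
  previous j refl = begin
    idx (toℕ (idx (suc (toℕ j))) + end)   ≡⟨ cong (λ a → idx (a + end)) (toℕ-idx (suc (toℕ j))) ⟩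
    idx (suc (toℕ j) % M + end)           ≡⟨ idx-cong (suc (toℕ j) % M + end) (suc (toℕ j) + end) (%-+ˡ (suc (toℕ j)) end) ⟩
    idx (suc (toℕ j) + end)               ≡⟨ cong idx (sym (+-suc (toℕ j) end)) ⟩
    idx (toℕ j + M)                       ≡⟨ idx-+M (toℕ j) ⟩
    idx (toℕ j)                           ≡⟨ idx-toℕ j ⟩
    j                                     ∎
    where open ≡-Reasoning

  sucp<M : suc p < M
  sucp<M = s≤s p<end

  cover-outer-outer : ∀ i j → Covered (outer i) (outer j)
  cover-outer-outer i j with related i j
  ... | adjacent e = x-below 1 (blk (toℕ i) v₁) (blk-∈ (Fin.toℕ<n i) v₁-∈) (X≡ (outer-idx i)) (Y≡ (outer≡ (previous j e)))
  ... | inS k k<p e = x-below 1 (blk (toℕ i) (sC k)) (blk-∈ (Fin.toℕ<n i) (sC-∈ k<p)) (X≡ (outer-idx i)) (Y≡ (outer≡ e))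
  ... | inR k k≤q e with k ≟ q
  ...   | yes refl = x-below 3 (blk (toℕ j) u₁) (blk-∈ (Fin.toℕ<n j) u₁-∈) (X≡ (outer≡ e)) (Y≡ (outer-idx j))
  ...   | no k≢q   = x-below 3 (blk (toℕ j) (rA k)) (blk-∈ (Fin.toℕ<n j) (rA-∈ (≤∧≢⇒< k≤q k≢q))) (X≡ (outer≡ e)) (Y≡ (outer-idx j))
  cover-outer-outer i j | equal refl with toℕ i ≟ end
  ...   | no i≢end = x-below 1 (blk (toℕ i) u₄) (blk-∈ (Fin.toℕ<n i) u₄-∈) (X≡ (outer-idx i)) (Y≡ (trans (second-u₄ i≢end) (outer-idx i)))
  ...   | yes eq   = 1 , 4 , last , last-∈ , inj₁ (tower (s≤s (s≤s z≤n)) (X≡ (outer≡ end≡i)) (Y≡ (outer≡ end≡i)) empty)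
    where
    end≡i : idx end ≡ i
    end≡i = trans (cong idx (sym eq)) (idx-toℕ i)
    empty : ∀ {r} → r < 4 → 1 < r → content r last ≡ nothing
    empty {1} _ (s≤s ())
    empty {2} _ _ = refl
    empty {3} _ _ = refl
    empty {suc (suc (suc (suc _)))} (s≤s (s≤s (s≤s (s≤s ())))) _

  cover-outer-inner : ∀ i j → Covered (outer i) (inner j)
  cover-outer-inner i j with related i j
  ... | equal refl  = x-below 1 (blk (toℕ i) long) (blk-∈ (Fin.toℕ<n i) long-∈) (X≡ (outer-idx i)) (Y≡ (inner-idx i))
  ... | inS k k<p e = x-below 1 (blk (toℕ i) (sD k)) (blk-∈ (Fin.toℕ<n i) (sD-∈ k<p)) (X≡ (outer-idx i)) (Y≡ (inner≡ e))
  ... | inR k k≤q e with k ≟ q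
  ...   | yes refl = y-below 2 (blk (toℕ j) u₁) (blk-∈ (Fin.toℕ<n j) u₁-∈) (Y≡ (inner-idx j)) (X≡ (outer≡ e))
  ...   | no k≢q   = y-below 2 (blk (toℕ j) (rA k)) (blk-∈ (Fin.toℕ<n j) (rA-∈ (≤∧≢⇒< k≤q k≢q))) (Y≡ (inner-idx j)) (X≡ (outer≡ e))
  cover-outer-inner i j | adjacent e with toℕ j ≟ p
  ...   | no j≢p = x-below 3 (blk (spareBlock j) u₂) (blk-∈ (fwd<M j (2 + q)) u₂-∈) (X≡ (outer≡ (trans (back-spare′ j) e))) (Y≡ (late-spare j j≢p))
  ...   | yes eq = x-below 1 (blk (suc p) v₂) (blk-∈ sucp<M v₂-∈) (X≡ (outer≡ (trans (cong (idx ∘ suc) (sym eq)) e)))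
                     (Y≡ (trans second-v₂ (inner≡ (trans (cong idx (sym eq)) (idx-toℕ j)))))

  -- The delicate difference is -(q + 1): when B (j - 1 - q) appears in u₃, row 4 has already passed
  -- from C j to the spare D. Hence C j is met from below in u₄, except in the last block, where it
  -- still lies above.
  cover-inner-outer : ∀ i j → Covered (inner i) (outer j)
  cover-inner-outer i j with related i j
  ... | equal refl  = x-below 3 (blk (toℕ i) v₂) (blk-∈ (Fin.toℕ<n i) v₂-∈) (X≡ (inner-idx i)) (Y≡ (outer-idx i))
  ... | adjacent e  = y-below 2 (blk (toℕ i) v₁) (blk-∈ (Fin.toℕ<n i) v₁-∈) (Y≡ (outer≡ (previous j e))) (X≡ (inner-idx i))
  ... | inS k k<p e = y-below 2 (blk (toℕ i) (sC k)) (blk-∈ (Fin.toℕ<n i) (sC-∈ k<p)) (Y≡ (outer≡ e)) (X≡ (inner-idx i))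
  ... | inR k k≤q e with k ≟ q
  ...   | no k≢q = x-below 3 (blk (toℕ j) (rB k)) (blk-∈ (Fin.toℕ<n j) (rB-∈ (≤∧≢⇒< k≤q k≢q))) (X≡ (inner≡ e)) (Y≡ (outer-idx j))
  ...   | yes refl with toℕ j ≟ end
  ...     | no j≢end = y-below 2 (blk (toℕ j) u₄) (blk-∈ (Fin.toℕ<n j) u₄-∈) (Y≡ (trans (second-u₄ j≢end) (outer-idx j))) (X≡ (inner≡ e))
  ...     | yes eq   = x-below 3 (blk (toℕ j) u₃) (blk-∈ (Fin.toℕ<n j) u₃-∈) (X≡ (inner≡ e))
                         (Y≡ (trans (trans (cong late eq) late-end) (outer≡ (trans (cong idx (sym eq)) (idx-toℕ j)))))

  cover-inner-inner : ∀ i j → Covered (inner i) (inner j)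
  cover-inner-inner i j with related i j
  ... | equal refl  = y-below 2 (blk (toℕ i) long) (blk-∈ (Fin.toℕ<n i) long-∈) (Y≡ (inner-idx i)) (X≡ (inner-idx i))
  ... | inS k k<p e = y-below 2 (blk (toℕ i) (sD k)) (blk-∈ (Fin.toℕ<n i) (sD-∈ k<p)) (Y≡ (inner≡ e)) (X≡ (inner-idx i))
  ... | inR k k≤q e with k ≟ q
  ...   | yes refl = y-below 2 (blk (toℕ j) u₃) (blk-∈ (Fin.toℕ<n j) u₃-∈) (Y≡ (inner-idx j)) (X≡ (inner≡ e))
  ...   | no k≢q   = y-below 2 (blk (toℕ j) (rB k)) (blk-∈ (Fin.toℕ<n j) (rB-∈ (≤∧≢⇒< k≤q k≢q))) (Y≡ (inner-idx j)) (X≡ (inner≡ e))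
  cover-inner-inner i j | adjacent e with toℕ j ≟ p
  ...   | no j≢p = x-below 3 (blk (spareBlock j) u₃) (blk-∈ (fwd<M j (2 + q)) u₃-∈) (X≡ (inner≡ (trans (back-spare′ j) e))) (Y≡ (late-spare j j≢p))
  ...   | yes eq = y-below 2 (blk (suc p) v₂) (blk-∈ sucp<M v₂-∈)
                     (Y≡ (trans second-v₂ (inner≡ (trans (cong idx (sym eq)) (idx-toℕ j))))) (X≡ (inner≡ (trans (cong (idx ∘ suc) (sym eq)) e)))

  -- The top bar sees only row 4, which D j enters with its spare bar. The spare bar of D p is in
  -- row 2, so the extra X comes down to row 3 above the long bar of D p.
  cover-extra-inner : ∀ x j → Covered (extra x) (inner j)
  cover-extra-inner x j with toℕ j ≟ p
  ... | no j≢p = y-below 4 (blk (spareBlock j) u₂) (blk-∈ (fwd<M j (2 + q)) u₂-∈) (Y≡ (late-spare j j≢p)) (content₅ x first)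
  ... | yes eq = y-below 2 (blk p swap) (blk-∈ (m≤n⇒m≤1+n p<end) swap-∈)
                   (Y≡ (inner≡ (trans (cong idx (sym eq)) (idx-toℕ j)))) (X≡ (swap-extra x))

  -- The extra Y bar in row 4 from u₄ of block k to v₁ of block k + 1 meets B (k - 1 - q) and B (k +
  -- 1). For k ≤ p the latter are B 1 to B (p + 1); for k ≤ q, allowed by q ≤ p, the former are B (p
  -- + 2) to B end. B 0 sees the bottom bar in `first`.
  cover-inner-extra : ∀ i y → Covered (inner i) (extra y)
  cover-inner-extra i y = go (toℕ i) refl
    where
    named : ∀ {a} → a ≡ toℕ i → idx a ≡ i
    named eq = trans (cong idx eq) (idx-toℕ i)
    go : ∀ a → a ≡ toℕ i → Covered (inner i) (extra y)
    go zero eq = 0 , 3 , first , here refl , inj₂ (tower (s≤s z≤n) (content₀ y first) (X≡ (inner≡ (named eq))) empty)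
      where
      empty : ∀ {r} → r < 3 → 0 < r → content r first ≡ nothing
      empty {1} _ _ = refl
      empty {2} _ _ = refl
      empty {suc (suc (suc _))} (s≤s (s≤s (s≤s ()))) _
    go (suc a) eq with a ≤? p
    ... | yes a≤p = x-below 3 (blk (suc a) v₁) (blk-∈ (≤-<-trans (≤-reflexive eq) (Fin.toℕ<n i)) v₁-∈) (X≡ (inner≡ (named eq))) (Y≡ (turn-extra y a≤p))
    ... | no a≰p = x-below 3 (blk k u₄) (blk-∈ (≤-<-trans k≤p (m≤n⇒m≤1+n p<end)) u₄-∈)
                     (X≡ (inner≡ (trans (cong idx k+) (named eq)))) (Y≡ (turn-extra y k≤p))
      where
      k = a ∸ suc p
      a≤ : a ≤ suc (p + q)
      a≤ = s≤s⁻¹ (s≤s⁻¹ (≤-trans (s≤s (≤-reflexive eq)) (Fin.toℕ<n i)))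
      k≤p : k ≤ p
      k≤p = ≤-trans (∸-monoˡ-≤ (suc p) a≤) (≤-trans (≤-reflexive (m+n∸m≡n (suc p) q)) q≤p)
      k+ : k + (M ∸ suc q) ≡ suc a
      k+ = begin
        k + (2 + (p + q) ∸ q)   ≡⟨ cong (k +_) (m+n∸n≡m (2 + p) q) ⟩
        k + (2 + p)             ≡⟨ +-suc k (suc p) ⟩
        suc (k + suc p)         ≡⟨ cong suc (m∸n+n≡m (≰⇒> a≰p)) ⟩
        suc a                   ∎
        where open ≡-Reasoning

  cover : ∀ u v → Covered u v
  cover (outer i) (outer j) = cover-outer-outer i j
  cover (outer i) (inner j) = cover-outer-inner i j
  cover (outer i) (extra y) = y-below 0 (blk (toℕ i) v₁) (blk-∈ (Fin.toℕ<n i) v₁-∈) (content₀ y first) (X≡ (outer-idx i))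
  cover (inner i) (outer j) = cover-inner-outer i j
  cover (inner i) (inner j) = cover-inner-inner i j
  cover (inner i) (extra y) = cover-inner-extra i y
  cover (extra x) (outer j) = y-below 4 (blk (toℕ j) v₂) (blk-∈ (Fin.toℕ<n j) v₂-∈) (Y≡ (outer-idx j)) (content₅ x first)
  cover (extra x) (inner j) = cover-extra-inner x j
  cover (extra x) (extra y) = y-below 4 (blk 0 u₄) (blk-∈ (s≤s z≤n) u₄-∈) (Y≡ (turn-extra y z≤n)) (content₅ x first)

  family-barRep : ∀ {n} → Fin n ↔ Side → BarRep (K n) t
  family-barRep = Sequence.sequence-barRep first rest high alternating cover distinct initial (Linked.map proj₁ linked)

-- Choice of the parameters and the two bounds together

sides : ∀ m e → Fin (m + m + e) ↔ ((Fin m ⊎ Fin m) ⊎ Fin e)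
sides m e = (Fin.+↔⊎ {m} {m} ⊎-↔ ↔-id (Fin e)) ↔-∘ Fin.+↔⊎ {m + m} {e}

even-barRep : ∀ p q → q ≤ p → BarRep (K ((3 + (p + q)) + (3 + (p + q)) + 0)) (2 + p)
even-barRep p q q≤p = Family.family-barRep p q q≤p {Fin 0} Fin._≟_ nothing (λ ()) (sides (3 + (p + q)) 0)

odd-barRep : ∀ p q → q ≤ p → BarRep (K ((3 + (p + q)) + (3 + (p + q)) + 1)) (2 + p)
odd-barRep p q q≤p = Family.family-barRep p q q≤p {Fin 1} Fin._≟_ (just zero) (λ { zero → refl }) (sides (3 + (p + q)) 1)

quarter : ∀ s k → s < 4 → (s + k * 4) / 4 ≡ k
quarter s k s<4 = trans (+-distrib-/-∣ʳ s (n∣m*n k)) (cong₂ _+_ (m<n⇒m/n≡0 s<4) (m*n/n≡m k 4))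

transport : ∀ {m n t u} → m ≡ n → t ≡ u → BarRep (K m) t → BarRep (K n) u
transport refl refl R = R

-- Write m = r + 4a with r < 4 and take q = a: the extra vertices are present for odd r, and p is a
-- for r < 2 and a + 1 otherwise.
large-barRep : ∀ m → BarRep (K (6 + m)) ⌈ (6 + m) + 1 /4⌉
large-barRep m = subst (λ m → BarRep (K (6 + m)) ⌈ (6 + m) + 1 /4⌉) (sym (m≡m%n+[m/n]*n m 4)) (residue (m % 4) (m / 4) (m%n<n m 4))
  where
  count : ∀ r s a b → s < 4 → 6 + (r + a * 4) + 1 + 3 ≡ s + b * 4 → b ≡ ⌈ (6 + (r + a * 4)) + 1 /4⌉
  count r s a b s<4 eq = sym (trans (cong (_/ 4) eq) (quarter s b s<4))
  n₀ : ∀ a → (3 + (a + a)) + (3 + (a + a)) + 0 ≡ 6 + (0 + a * 4)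
  n₀ = solve-∀
  n₁ : ∀ a → (3 + (a + a)) + (3 + (a + a)) + 1 ≡ 6 + (1 + a * 4)
  n₁ = solve-∀
  n₂ : ∀ a → (3 + (suc a + a)) + (3 + (suc a + a)) + 0 ≡ 6 + (2 + a * 4)
  n₂ = solve-∀
  n₃ : ∀ a → (3 + (suc a + a)) + (3 + (suc a + a)) + 1 ≡ 6 + (3 + a * 4)
  n₃ = solve-∀
  c₀ : ∀ a → 6 + (0 + a * 4) + 1 + 3 ≡ 2 + (2 + a) * 4
  c₀ = solve-∀
  c₁ : ∀ a → 6 + (1 + a * 4) + 1 + 3 ≡ 3 + (2 + a) * 4
  c₁ = solve-∀
  c₂ : ∀ a → 6 + (2 + a * 4) + 1 + 3 ≡ 0 + (3 + a) * 4
  c₂ = solve-∀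
  c₃ : ∀ a → 6 + (3 + a * 4) + 1 + 3 ≡ 1 + (3 + a) * 4
  c₃ = solve-∀
  residue : ∀ r a → r < 4 → BarRep (K (6 + (r + a * 4))) ⌈ (6 + (r + a * 4)) + 1 /4⌉
  residue 0 a _ = transport (n₀ a) (count 0 2 a (2 + a) (s≤s (s≤s (s≤s z≤n))) (c₀ a)) (even-barRep a a ≤-refl)
  residue 1 a _ = transport (n₁ a) (count 1 3 a (2 + a) ≤-refl (c₁ a)) (odd-barRep a a ≤-refl)
  residue 2 a _ = transport (n₂ a) (count 2 0 a (3 + a) (s≤s z≤n) (c₂ a)) (even-barRep (suc a) a (n≤1+n a))
  residue 3 a _ = transport (n₃ a) (count 3 1 a (3 + a) (s≤s (s≤s z≤n)) (c₃ a)) (odd-barRep (suc a) a (n≤1+n a))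
  residue (suc (suc (suc (suc _)))) a (s≤s (s≤s (s≤s (s≤s ()))))

upper : ∀ n → n ≢ 0 → n ≢ 3 → BarRep (K n) ⌈ n + 1 /4⌉
upper 0 n≢0 _ = contradiction refl n≢0
upper 1 _ _   = K₁
upper 2 _ _   = K₂
upper 3 _ n≢3 = contradiction refl n≢3
upper 4 _ _   = K₄
upper 5 _ _   = K₅
upper (suc (suc (suc (suc (suc (suc m)))))) _ _ = large-barRep m

double-count : ∀ n s → (n + n) * s + (n + n) * s ≡ n * (4 * s)
double-count = solve-∀

-- From 2N ≤ 4ns ≤ n² the contradiction comes only through the saved four, since equality holds
-- throughout if n = 4s. With at most two bars n² ≤ 4, whereas s ≥ 1 forces n ≥ 4 and s = 0 leaves
-- no bar at all.
no-rep : ∀ {n s} → n ≢ 0 → 4 * s ≤ n → ¬ BarRep (K n) s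
no-rep {n} {s} n≢0 4s≤n R with edge-bound R
... | N , N≤ , n²≤2N , big with 3 ≤? N
... | yes 3≤N = m+1+n≰m (n * n) (begin
  n * n + 4                        ≤⟨ big 3≤N ⟩
  N + N                            ≤⟨ +-mono-≤ N≤ N≤ ⟩
  (n + n) * s + (n + n) * s        ≡⟨ double-count n s ⟩
  n * (4 * s)                      ≤⟨ *-monoʳ-≤ n 4s≤n ⟩
  n * n                            ∎)
  where open ≤-Reasoning
... | no 3≰N = none n s n≢0 4s≤n N≤ n²≤2N (≤-trans n²≤2N (+-mono-≤ N≤2 N≤2))
  where
  N≤2 : N ≤ 2
  N≤2 = s≤s⁻¹ (≰⇒> 3≰N)
  none : ∀ n s → n ≢ 0 → 4 * s ≤ n → N ≤ (n + n) * s → n * n ≤ N + N → n * n ≤ 4 → ⊥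
  none zero    s       n≢0 _    _  _   _ = n≢0 refl
  none (suc n) zero    _   _    N≤ n²≤ _ with refl ← n≤0⇒n≡0 (≤-trans N≤ (≤-reflexive (*-zeroʳ (suc n + suc n)))) = contradiction n²≤ (λ ())
  none (suc n) (suc s) _   4s≤n _  _ n²≤4 = contradiction (≤-trans (*-mono-≤ 4≤n 4≤n) n²≤4) (<⇒≱ (m≤n+m 5 11))
    where
    4≤n : 4 ≤ suc n
    4≤n = ≤-trans (*-monoʳ-≤ 4 (s≤s (z≤n {s}))) 4s≤n

lower : ∀ n → n ≢ 0 → ∀ s → BarRep (K n) s → ⌈ n + 1 /4⌉ ≤ s
lower n n≢0 s R with ⌈ n + 1 /4⌉ ≤? s
... | yes le = le
... | no nle = contradiction R (no-rep n≢0 (+-cancelˡ-≤ 4 (4 * s) n (begin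
  4 + 4 * s                        ≡⟨ *-suc 4 s ⟨
  4 * suc s                        ≡⟨ *-comm 4 (suc s) ⟩
  suc s * 4                        ≤⟨ *-monoˡ-≤ 4 (≰⇒> nle) ⟩
  (n + 1 + 3) / 4 * 4              ≤⟨ m/n*n≤m (n + 1 + 3) 4 ⟩
  n + 1 + 3                        ≡⟨ +-assoc n 1 3 ⟩
  n + 4                            ≡⟨ +-comm n 4 ⟩
  4 + n                            ∎)))
  where open ≤-Reasoning

-- The general bound gives only 1. One bar per vertex means N ≤ 6, and 9 + 4 = 13 exceeds 12 by one,
-- so all four saved adjacencies are used.
lower₃ : ∀ s → BarRep (K 3) s → 2 ≤ s
lower₃ zero          R = contradiction R (no-rep (λ ()) z≤n)
lower₃ (suc (suc s)) R = s≤s (s≤s z≤n)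
lower₃ (suc zero)    R with edge-bound R
... | N , N≤6 , 9≤2N , big with 3 ≤? N
...   | yes 3≤N = contradiction (≤-trans (big 3≤N) (+-mono-≤ N≤6 N≤6)) (<⇒≱ ≤-refl)
...   | no 3≰N  = contradiction (≤-trans 9≤2N (+-mono-≤ (s≤s⁻¹ (≰⇒> 3≰N)) (s≤s⁻¹ (≰⇒> 3≰N)))) (<⇒≱ (m≤n+m 5 4))

theorem5 : ((n : ℕ) → n ≢ 0 → n ≢ 3 → BarVisNumberIs (K n) ⌈ n + 1 /4⌉)
    × BarVisNumberIs (K 3) 2
theorem5 = (λ n n≢0 n≢3 → upper n n≢0 n≢3 , lower n n≢0) , (K₃ , lower₃)
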